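{- For every constant $\beta\in(0,1]$ there exists a constant $c=c(\beta)>0$ such that for all integers $n,m\ge1$, all finite sets $X_1,X_2,\dots,X_n\subset\mathbb{R}^m$, and all (possibly partial) Boolean functions $g_i$ on $X_i$ ($i=1,2,\dots,n$), $$\deg_{1-\beta^n}\left(\bigotimes_{i=1}^n g_i\right)\ \ge\ c\min_{S\subseteq\{1,\dots,n\},\ |S|=\lceil0.99n\rceil}\left\{\sum_{i\in S}\deg_{1/3}(g_i)\right\}.$$
   Context: A (possibly partial) Boolean function $g$ on a finite set $X$ is a map $g:\operatorname{dom}g\to\{ -1,+1\}$ with $\varnothing\ne\operatorname{dom}g\subseteq X$ (total if $\operatorname{dom}g=X$, partial otherwise). For finite $X\subset\mathbb{R}^N$ and $\epsilon\ge0$, $\deg_\epsilon(g)$ is the least degree of a real polynomial $p$ such that $|g(x)-p(x)|\le\epsilon$ for $x\in\operatorname{dom}g$ and $|p(x)|\le1+\epsilon$ for $x\in X\setminus\operatorname{dom}g$. $\bigotimes_{i=1}^n g_i$ is the (possibly partial) Boolean function on $\prod X_i\subset\mathbb{R}^{mn}$ with domain $\prod\operatorname{dom}g_i$ and value $\prod_{i=1}^n g_i(x_i)$ at $(x_1,\dots,x_n)$. -}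

module Defs where

open import Algebra.Bundles using (CommutativeRing; Semiring)
open import Algebra.Core using (Op₁; Op₂)
open import Algebra.Structures using (IsCommutativeRing)
import Algebra.Definitions.RawMonoid as RawMonoid
import Algebra.Definitions.RawSemiring as RawSemiring
import Algebra.Properties.CommutativeMonoid.Sum as Sum
open import Data.Bool.Base using (if_then_else_)
open import Data.Fin.Base using (Fin; combine; remQuot)
open import Data.Fin.Properties using (remQuot-combine)
open import Data.Fin.Subset using (Subset; ∣_∣)
open import Data.List.Base as List using (List)
open import Data.List.Relation.Unary.All using (All)
open import Data.List.Relation.Unary.Any using (Any)
open import Data.Nat.Base as ℕ using (ℕ)
import Data.Nat.DivMod as ℕ
import Data.Nat.Properties as ℕ
open import Data.Product.Base using (Σ; ∃; _×_; _,_; proj₁; proj₂)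
open import Data.Sign.Base using (Sign)
import Data.Sign.Properties as Sign
open import Data.Sum.Base using ([_,_]′)
import Data.Vec.Base as Vec
open import Data.Vec.Functional using (Vector)
open import Level using (0ℓ)
open import Relation.Binary.Core using (Rel)
open import Relation.Binary.Definitions using (_Respects_)
open import Relation.Binary.PropositionalEquality using (_≡_; cong)
open import Relation.Binary.Structures using (IsTotalOrder)
open import Relation.Nullary.Negation using (¬_)
open import Relation.Unary using (Pred; _∈_; _∉_; _⊆_; Satisfiable)

module ∑ℕ = Sum ℕ.+-0-commutativeMonoid
module ∏Sign = Sum Sign.*-commutativeMonoid

------------------------------------------------------------------------
-- The real numbers, axiomatised as a Dedekind-complete ordered field
-- (unique up to isomorphism).  Equality is a setoid equality, as there
-- are no quotients.

record RealNumbers : Set₁ where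
  infix  9 _⁻¹
  infix  8 -_
  infixl 7 _*_
  infixl 6 _+_
  infix  4 _≈_ _≤_
  field
    ℝ     : Set
    _≈_   : Rel ℝ 0ℓ
    _≤_   : Rel ℝ 0ℓ
    _+_   : Op₂ ℝ
    _*_   : Op₂ ℝ
    -_    : Op₁ ℝ
    _⁻¹   : Op₁ ℝ      -- the value at 0 is unconstrained
    0#    : ℝ
    1#    : ℝ

    isCommutativeRing : IsCommutativeRing _≈_ _+_ _*_ -_ 0# 1#
    0≉1               : ¬ 0# ≈ 1#
    *-inverseʳ        : ∀ x → ¬ x ≈ 0# → x * x ⁻¹ ≈ 1#

    isTotalOrder      : IsTotalOrder _≈_ _≤_
    +-monoˡ-≤         : ∀ z {x y} → x ≤ y → x + z ≤ y + z
    *-nonneg          : ∀ {x y} → 0# ≤ x → 0# ≤ y → 0# ≤ x * y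

  UpperBound : Pred ℝ 0ℓ → Pred ℝ 0ℓ
  UpperBound P b = ∀ x → x ∈ P → x ≤ b

  field
    complete : (P : Pred ℝ 0ℓ) → Satisfiable P → Satisfiable (UpperBound P) →
               ∃ λ s → s ∈ UpperBound P × (∀ b → b ∈ UpperBound P → s ≤ b)

  commutativeRing : CommutativeRing 0ℓ 0ℓ
  commutativeRing = record { isCommutativeRing = isCommutativeRing }

  open CommutativeRing commutativeRing public
    using (_-_; semiring; +-rawMonoid; +-commutativeMonoid; *-commutativeMonoid)
  open RawSemiring (Semiring.rawSemiring semiring) public using (_^_)
  open IsTotalOrder isTotalOrder public using (total)

  infix 4 _<_
  _<_ : Rel ℝ 0ℓ
  x < y = x ≤ y × ¬ x ≈ y

  abs : Op₁ ℝ
  abs x = [ (λ _ → x) , (λ _ → - x) ]′ (total 0# x)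

  fromℕ : ℕ → ℝ
  fromℕ n = RawMonoid._×_ +-rawMonoid n 1#

  ⅓ : ℝ
  ⅓ = fromℕ 3 ⁻¹

  module ∑ = Sum +-commutativeMonoid
  module ∏ = Sum *-commutativeMonoid

------------------------------------------------------------------------
-- Minima and index sets

IsLeast : ∀ {ℓ} → Pred ℕ ℓ → Pred ℕ ℓ
IsLeast P d = d ∈ P × (∀ d′ → d′ ∈ P → d ℕ.≤ d′)

∑[_]_ : ∀ {n} → Subset n → Vector ℕ n → ℕ
∑[ S ] f = ∑ℕ.sum (λ i → if Vec.lookup S i then f i else 0)

-- ⌈a / b⌉ for natural numbers.
⌈_/_⌉ : (a b : ℕ) → .{{ℕ.NonZero b}} → ℕ
⌈ a / b ⌉ = (a ℕ.+ ℕ.pred b) ℕ./ b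

-- s is the minimum of ∑_{i∈S} f i over S ⊆ {1,…,n} with |S| = k.
IsMinSubsetSum : ∀ {n} → ℕ → Vector ℕ n → Pred ℕ 0ℓ
IsMinSubsetSum {n} k f = IsLeast (λ s → ∃ λ (S : Subset n) → ∣ S ∣ ≡ k × s ≡ ∑[ S ] f)

------------------------------------------------------------------------

module ApproximateDegree (R : RealNumbers) where
  open RealNumbers R

  Point : ℕ → Set
  Point N = Vector ℝ N

  infix 4 _≋_
  _≋_ : ∀ {N} → Rel (Point N) 0ℓ
  x ≋ y = ∀ j → x j ≈ y j

  record IsFiniteSet {N} (X : Pred (Point N) 0ℓ) : Set where
    field
      respects   : X Respects _≋_
      elements   : List (Point N)
      exhaustive : ∀ x → x ∈ X → Any (x ≋_) elements

  -- A formal sum of terms (c , α) denoting c · x₁^α₁ ⋯ x_N^α_N.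
  Polynomial : ℕ → Set
  Polynomial N = List (ℝ × Vector ℕ N)

  eval : ∀ {N} → Polynomial N → Point N → ℝ
  eval p x = List.foldr (λ (c , α) s → c * ∏.sum (λ j → x j ^ α j) + s) 0# p

  -- Repeated exponents and zero coefficients are allowed, so this bounds
  -- the degree of the formal sum.  The polynomials so obtained are the
  -- linear combinations of monomials of total degree at most d, that is,
  -- exactly the real polynomials of degree at most d.
  DegreeAtMost : ∀ {N} → ℕ → Pred (Polynomial N) 0ℓ
  DegreeAtMost d = All (λ (_ , α) → ∑ℕ.sum α ℕ.≤ d)

  -- Possibly partial Boolean functions on X with values in {-1,+1} ≅ Sign.
  -- By value-cong the value does not depend on the proof of x ∈ dom.
  record BooleanFunction {N} (X : Pred (Point N) 0ℓ) : Set₁ where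
    field
      dom          : Pred (Point N) 0ℓ
      dom-respects : dom Respects _≋_
      dom⊆X        : dom ⊆ X
      dom-nonempty : Satisfiable dom
      value        : ∀ x → x ∈ dom → Sign
      value-cong   : ∀ {x y} (x∈ : x ∈ dom) (y∈ : y ∈ dom) → x ≋ y →
                     value x x∈ ≡ value y y∈

  ⟦_⟧ : Sign → ℝ
  ⟦ Sign.+ ⟧ = 1#
  ⟦ Sign.- ⟧ = - 1#

  record Approximates {N} {X : Pred (Point N) 0ℓ} (ε : ℝ)
                      (g : BooleanFunction X) (p : Polynomial N) : Set where
    open BooleanFunction g
    field
      close   : ∀ x (x∈ : x ∈ dom) → abs (⟦ value x x∈ ⟧ - eval p x) ≤ ε
      bounded : ∀ x → x ∈ X → x ∉ dom → abs (eval p x) ≤ 1# + ε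

  -- deg_ε(g) = d.
  IsDeg : ∀ {N} {X : Pred (Point N) 0ℓ} → ℝ → BooleanFunction X → Pred ℕ 0ℓ
  IsDeg {N} ε g = IsLeast λ d →
    Σ (Polynomial N) λ p → p ∈ DegreeAtMost d × Approximates ε g p

  -- The i-th component of x = (x₁,…,xₙ) ∈ (ℝ^m)ⁿ = ℝ^{nm}.
  block : ∀ {n m} → Fin n → Point (n ℕ.* m) → Point m
  block i x j = x (combine i j)

  ∏Set : ∀ {n m} → (Fin n → Pred (Point m) 0ℓ) → Pred (Point (n ℕ.* m)) 0ℓ
  ∏Set X x = ∀ i → block i x ∈ X i

  ⨂ : ∀ {n m} {X : Fin n → Pred (Point m) 0ℓ} →
      (∀ i → BooleanFunction (X i)) → BooleanFunction (∏Set X)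
  ⨂ {n} {m} {X} g = record
    { dom          = ∏Set dom
    ; dom-respects = λ x≋y x∈ i → dom-respects i (λ j → x≋y (combine i j)) (x∈ i)
    ; dom⊆X        = λ x∈ i → dom⊆X i (x∈ i)
    ; dom-nonempty = join , λ i → dom-respects i (λ j → sym (block-join i j))
                                    (proj₂ (dom-nonempty i))
    ; value        = λ x x∈ → ∏Sign.sum (λ i → value i (block i x) (x∈ i))
    ; value-cong   = λ x∈ y∈ x≋y → ∏Sign.sum-cong-≗ λ i →
                       value-cong i (x∈ i) (y∈ i) (λ j → x≋y (combine i j))
    }
    where
    open module G i = BooleanFunction (g i)
    open CommutativeRing commutativeRing using (sym; reflexive)

    join : Point (n ℕ.* m)
    join k = let i , j = remQuot m k in proj₁ (dom-nonempty i) j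

    block-join : ∀ i → block i join ≋ proj₁ (dom-nonempty i)
    block-join i j = reflexive
      (cong (λ (i′ , j′) → proj₁ (dom-nonempty i′) j′) (remQuot-combine {n} {m} i j))

{-# OPTIONS --safe #-}
-- Fix a small constant δ = δ(β).  Composing an approximant with an iterate of
-- (3t - t³)/2 shows deg_{1-δ}(gᵢ) ≥ K⁻¹ deg_{1/3}(gᵢ), so by LP duality there are
-- signed measures ψᵢ orthogonal to all polynomials of degree less than
-- K⁻¹ deg_{1/3}(gᵢ) which have total mass 1 on points where their sign agrees with
-- gᵢ and mass at most δ elsewhere.  Let z be the number of coordinates of the
-- second kind and k = ⌊n/100⌋.  The product of the ψᵢ times Σ_{j≤k} (-1)ʲ C(z,j) is
-- supported on z = 0, where it has mass 1 and the sign of ⨂ gᵢ, and on z > k, where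
-- its mass is at most 4ⁿ δᵏ⁺¹, which is negligible against βⁿ.  The factor in z only
-- destroys the orthogonality in k coordinates, so the measure is orthogonal to all
-- polynomials of degree less than K⁻¹ min_{|S| = n-k} Σ_{i∈S} deg_{1/3}(gᵢ).  A
-- polynomial p with |p - ⨂ gᵢ| ≤ 1 - βⁿ has correlation at least βⁿ with ⨂ gᵢ on
-- z = 0, so it cannot be orthogonal to the measure.
module Submission where

-- The plain product of the ψᵢ can have mass (1 + δ)ⁿ - 1 off z = 0, which no constant δ keeps below
-- βⁿ for all n, so points with few errors must be removed exactly. The alternating sum does this
-- because for z ≥ 1 it equals (-1)ᵏ C(z-1,k), which vanishes for 1 ≤ z ≤ k. Moreover C(z,j) is the
-- sum, over the j-element sets of coordinates, of the indicator that all of them are errors, so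
-- each term modifies the product in at most k coordinates. Constants: put γ = β/4 and δ = γ¹⁰⁰.
-- Since 100(k+1) > n, the tail 4ⁿ δᵏ⁺¹ is at most 4ⁿ γⁿ⁺¹ = γ βⁿ, and this stays below βⁿ after
-- multiplication by 2, a bound for |p| on the product set. The density is never written down: the
-- measure is an iterated integral and the density is carried by a recursion over the coordinates.
-- Degrees are given as least elements, so deg_{1-δ} does not occur either; what is shown is that no
-- combination of monomials α with K |α| < deg_{1/3}(gᵢ) approximates gᵢ to within 1 - δ.

open import Defs
open import Algebra.Bundles using (CommutativeMonoid; CommutativeRing)
import Algebra.Properties.CommutativeMonoid.Sum as Sum
import Algebra.Properties.CommutativeSemiring.Exp as Exp
import Algebra.Properties.Ring as RingProperties
import Algebra.Properties.Semiring.Mult as Mult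
import Algebra.Properties.Semiring.Mult.TCOptimised as TCMult
import Algebra.Properties.Semiring.Sum as SemiringSum
import Algebra.Solver.Ring as RingSolver
open import Algebra.Solver.Ring.AlmostCommutativeRing
  using (fromCommutativeRing; _-Raw-AlmostCommutative⟶_)
open import Axiom.ExcludedMiddle using (ExcludedMiddle)
open import Data.Bool.Base using (true; false)
open import Data.Empty using (⊥-elim)
open import Data.Fin.Base using (Fin; zero; suc; combine; remQuot; _↑ˡ_; _↑ʳ_)
open import Data.Fin.Properties using (remQuot-combine)
open import Data.Fin.Subset using (Subset; ⊥; ∣_∣)
open import Data.Fin.Subset.Properties using (∣⊥∣≡0)
open import Data.Integer.Base as ℤ using (ℤ; +_; -[1+_]; _⊖_; _◃_)
import Data.Integer.Properties as ℤ
open import Data.List.Base as Lists using (List)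
open import Data.List.Relation.Unary.All as Alls using (All)
import Data.List.Relation.Unary.All.Properties as AllP
open import Data.List.Relation.Unary.Any as Any using (Any; here; there)
import Data.List.Relation.Unary.Any.Properties as AnyP
open import Data.Maybe.Base using (Maybe; just; nothing)
open import Data.Nat.Base as ℕ using (ℕ; zero; suc; s≤s; z≤n)
import Data.Nat.DivMod as ℕ
import Data.Nat.Properties as ℕ
open import Data.Product.Base using (∃; _×_; _,_; proj₁; proj₂)
open import Data.Sign.Base as Sign using (Sign)
open import Data.Sum.Base using (_⊎_; inj₁; inj₂; [_,_]′)
import Data.Vec.Base as Vec
open import Data.Vec.Functional as Vector using (Vector; tail)
open import Level using (0ℓ)
open import Relation.Binary.Bundles using (Poset)
import Relation.Binary.PropositionalEquality as ≡
open ≡ using (_≡_)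
import Relation.Binary.Reasoning.PartialOrder as PartialOrderReasoning
import Relation.Binary.Reasoning.Setoid as SetoidReasoning
open import Relation.Binary.Structures using (IsTotalOrder)
open import Relation.Nullary.Decidable using (Dec; yes; no)
open import Relation.Nullary.Negation using (¬_; contradiction)
open import Relation.Unary using (Pred)

-- The ring solver with ℤ as coefficients.  Unlike the one whose
-- coefficients are natural numbers it knows about cancellation.
module IntegerCoefficients {a ℓ} (R : CommutativeRing a ℓ) where
  open CommutativeRing R
  open RingProperties ring
  open TCMult semiring renaming (_×_ to infixl 8 _×′_)
  open SetoidReasoning setoid

  private
    fromℤ : ℤ → Carrier
    fromℤ (+ n)    = n ×′ 1#
    fromℤ -[1+ n ] = - (suc n ×′ 1#)

    fromSign : Sign → Carrier
    fromSign Sign.+ = 1#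
    fromSign Sign.- = - 1#

    suc-× : ∀ n → suc n ×′ 1# ≈ 1# + n ×′ 1#
    suc-× = ×-homo-+ 1# 1

    cancel-suc : ∀ x y → x - y ≈ (1# + x) - (1# + y)
    cancel-suc x y = begin
      x - y                     ≈⟨ +-identityˡ _ ⟨
      0# + (x - y)              ≈⟨ +-congʳ (-‿inverseʳ 1#) ⟨
      (1# - 1#) + (x - y)       ≈⟨ +-assoc 1# (- 1#) _ ⟩
      1# + (- 1# + (x - y))     ≈⟨ +-congˡ (+-assoc (- 1#) x (- y)) ⟨
      1# + ((- 1# + x) - y)     ≈⟨ +-congˡ (+-congʳ (+-comm (- 1#) x)) ⟩
      1# + ((x - 1#) - y)       ≈⟨ +-congˡ (+-assoc x (- 1#) (- y)) ⟩
      1# + (x + (- 1# - y))     ≈⟨ +-assoc 1# x _ ⟨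
      (1# + x) + (- 1# - y)     ≈⟨ +-congˡ (-‿+-comm 1# y) ⟩
      (1# + x) - (1# + y)       ∎

    ⊖-homo : ∀ m n → fromℤ (m ⊖ n) ≈ m ×′ 1# - n ×′ 1#
    ⊖-homo m       zero    = sym (trans (+-congˡ -0#≈0#) (+-identityʳ _))
    ⊖-homo zero    (suc n) = sym (+-identityˡ _)
    ⊖-homo (suc m) (suc n) = begin
      fromℤ (suc m ⊖ suc n)          ≡⟨ ≡.cong fromℤ (ℤ.[1+m]⊖[1+n]≡m⊖n m n) ⟩
      fromℤ (m ⊖ n)                  ≈⟨ ⊖-homo m n ⟩
      m ×′ 1# - n ×′ 1#                ≈⟨ cancel-suc _ _ ⟩
      (1# + m ×′ 1#) - (1# + n ×′ 1#)  ≈⟨ +-cong (suc-× m) (-‿cong (suc-× n)) ⟨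
      suc m ×′ 1# - suc n ×′ 1#        ∎

    +-homo : ∀ i j → fromℤ (i ℤ.+ j) ≈ fromℤ i + fromℤ j
    +-homo (+ m)    (+ n)    = ×-homo-+ 1# m n
    +-homo (+ m)    -[1+ n ] = ⊖-homo m (suc n)
    +-homo -[1+ m ] (+ n)    = trans (⊖-homo n (suc m)) (+-comm _ _)
    +-homo -[1+ m ] -[1+ n ] = begin
      - (suc (suc (m ℕ.+ n)) ×′ 1#)     ≡⟨ ≡.cong (λ k → - (suc k ×′ 1#)) (≡.sym (ℕ.+-suc m n)) ⟩
      - ((suc m ℕ.+ suc n) ×′ 1#)       ≈⟨ -‿cong (×-homo-+ 1# (suc m) (suc n)) ⟩
      - (suc m ×′ 1# + suc n ×′ 1#)      ≈⟨ -‿+-comm _ _ ⟨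
      - (suc m ×′ 1#) - (suc n ×′ 1#)    ∎

    -- Integer multiplication is defined by multiplying signs and absolute values, so
    -- multiplicativity of `fromℤ` is proved through the same decomposition.
    ◃-homo : ∀ s n → fromℤ (s ◃ n) ≈ fromSign s * (n ×′ 1#)
    ◃-homo s      zero    = sym (zeroʳ _)
    ◃-homo Sign.+ (suc n) = sym (*-identityˡ _)
    ◃-homo Sign.- (suc n) = sym (-1*x≈-x _)

    sign-abs : ∀ i → fromℤ i ≈ fromSign (ℤ.sign i) * (ℤ.∣ i ∣ ×′ 1#)
    sign-abs i = trans (reflexive (≡.cong fromℤ (≡.sym (ℤ.signᵢ◃∣i∣≡i i)))) (◃-homo (ℤ.sign i) ℤ.∣ i ∣)

    fromSign-homo : ∀ s t → fromSign (s Sign.* t) ≈ fromSign s * fromSign t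
    fromSign-homo Sign.+ t      = sym (*-identityˡ _)
    fromSign-homo Sign.- Sign.+ = sym (*-identityʳ _)
    fromSign-homo Sign.- Sign.- = sym (trans (-1*x≈-x _) (-‿involutive 1#))

    interchange : ∀ w x y z → (w * x) * (y * z) ≈ (w * y) * (x * z)
    interchange w x y z = begin
      (w * x) * (y * z)  ≈⟨ *-assoc w x _ ⟩
      w * (x * (y * z))  ≈⟨ *-congˡ (*-assoc x y z) ⟨
      w * ((x * y) * z)  ≈⟨ *-congˡ (*-congʳ (*-comm x y)) ⟩
      w * ((y * x) * z)  ≈⟨ *-congˡ (*-assoc y x z) ⟩
      w * (y * (x * z))  ≈⟨ *-assoc w y _ ⟨
      (w * y) * (x * z)  ∎

    *-homo : ∀ i j → fromℤ (i ℤ.* j) ≈ fromℤ i * fromℤ j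
    *-homo i j = begin
      fromℤ (s Sign.* t ◃ m ℕ.* n)                        ≈⟨ ◃-homo (s Sign.* t) (m ℕ.* n) ⟩
      fromSign (s Sign.* t) * ((m ℕ.* n) ×′ 1#)            ≈⟨ *-cong (fromSign-homo s t) (×1-homo-* m n) ⟩
      (fromSign s * fromSign t) * ((m ×′ 1#) * (n ×′ 1#))   ≈⟨ interchange _ _ _ _ ⟩
      (fromSign s * (m ×′ 1#)) * (fromSign t * (n ×′ 1#))   ≈⟨ *-cong (sign-abs i) (sign-abs j) ⟨
      fromℤ i * fromℤ j                                   ∎
      where
      s = ℤ.sign i
      t = ℤ.sign j
      m = ℤ.∣ i ∣
      n = ℤ.∣ j ∣

    neg-homo : ∀ i → fromℤ (ℤ.- i) ≈ - fromℤ i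
    neg-homo (+ zero)  = sym -0#≈0#
    neg-homo (+ suc n) = refl
    neg-homo -[1+ n ]  = sym (-‿involutive _)

    homomorphism : ℤ.+-*-rawRing -Raw-AlmostCommutative⟶ fromCommutativeRing R
    homomorphism = record
      { ⟦_⟧ = fromℤ ; +-homo = +-homo ; *-homo = *-homo
      ; -‿homo = neg-homo ; 0-homo = refl ; 1-homo = refl }

    coeff≟ : ∀ i j → Maybe (fromℤ i ≈ fromℤ j)
    coeff≟ i j with i ℤ.≟ j
    ... | yes i≡j = just (reflexive (≡.cong fromℤ i≡j))
    ... | no  _   = nothing

  open RingSolver _ (fromCommutativeRing R) homomorphism coeff≟ public
    using (solve; _:=_; _:+_; _:*_; _:-_; :-_; con)

-- Order, absolute values and powers in the real numbers.

module OrderedField (R : RealNumbers) where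
  open RealNumbers R public
  open CommutativeRing commutativeRing public
    using ( refl; sym; trans; reflexive; +-cong; +-congˡ; +-congʳ; *-cong; *-congˡ; *-congʳ; -‿cong
          ; +-identityˡ; +-identityʳ; *-identityˡ; *-identityʳ; zeroˡ; zeroʳ; *-comm; *-assoc; +-comm
          ; commutativeSemiring)
  open Exp commutativeSemiring public using (^-homo-*; ^-assocʳ; ^-distrib-*; ^-congˡ)
  open Mult semiring using (×1-homo-*)
  open IntegerCoefficients commutativeRing public
  open IsTotalOrder isTotalOrder public
    using (antisym) renaming (refl to ≤-refl; reflexive to ≤-reflexive; trans to ≤-trans)

  poset : Poset _ _ _
  poset = record { isPartialOrder = IsTotalOrder.isPartialOrder isTotalOrder }

  open PartialOrderReasoning poset public hiding (step-<)

  -- With `solve` this reduces an inequality to the nonnegativity of an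
  -- expression for the difference of its sides.
  from-nonneg : ∀ {x y e} → 0# ≤ e → e ≈ y - x → x ≤ y
  from-nonneg {x} {y} {e} 0≤e e≈ = begin
    x            ≈⟨ +-identityˡ x ⟨
    0# + x       ≤⟨ +-monoˡ-≤ x 0≤e ⟩
    e + x        ≈⟨ +-congʳ e≈ ⟩
    (y - x) + x  ≈⟨ solve 2 (λ x y → (y :- x) :+ x := y) refl x y ⟩
    y            ∎

  to-nonneg : ∀ {x y} → x ≤ y → 0# ≤ y - x
  to-nonneg {x} {y} x≤y = begin
    0#     ≈⟨ solve 1 (λ x → con (+ 0) := x :- x) refl x ⟩
    x - x  ≤⟨ +-monoˡ-≤ (- x) x≤y ⟩
    y - x  ∎

  +-monoʳ-≤ : ∀ z {x y} → x ≤ y → z + x ≤ z + y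
  +-monoʳ-≤ z {x} {y} x≤y = begin
    z + x  ≈⟨ +-comm z x ⟩
    x + z  ≤⟨ +-monoˡ-≤ z x≤y ⟩
    y + z  ≈⟨ +-comm y z ⟩
    z + y  ∎

  +-mono-≤ : ∀ {w x y z} → w ≤ x → y ≤ z → w + y ≤ x + z
  +-mono-≤ {w} {x} {y} {z} w≤x y≤z = ≤-trans (+-monoˡ-≤ y w≤x) (+-monoʳ-≤ x y≤z)

  +-nonneg : ∀ {x y} → 0# ≤ x → 0# ≤ y → 0# ≤ x + y
  +-nonneg {x} {y} 0≤x 0≤y = begin
    0#       ≈⟨ +-identityˡ 0# ⟨
    0# + 0#  ≤⟨ +-mono-≤ 0≤x 0≤y ⟩
    x + y    ∎

  neg-mono : ∀ {x y} → x ≤ y → - y ≤ - x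
  neg-mono {x} {y} x≤y = from-nonneg (to-nonneg x≤y)
    (solve 2 (λ x y → y :- x := (:- x) :- (:- y)) refl x y)

  nonpos⇒neg-nonneg : ∀ {x} → x ≤ 0# → 0# ≤ - x
  nonpos⇒neg-nonneg {x} x≤0 = from-nonneg (to-nonneg x≤0)
    (solve 1 (λ x → con (+ 0) :- x := (:- x) :- con (+ 0)) refl x)

  *-monoˡ-≤ : ∀ {z x y} → 0# ≤ z → x ≤ y → z * x ≤ z * y
  *-monoˡ-≤ {z} {x} {y} 0≤z x≤y = from-nonneg (*-nonneg 0≤z (to-nonneg x≤y))
    (solve 3 (λ x y z → z :* (y :- x) := z :* y :- z :* x) refl x y z)

  *-monoʳ-≤ : ∀ {z x y} → 0# ≤ z → x ≤ y → x * z ≤ y * z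
  *-monoʳ-≤ {z} {x} {y} 0≤z x≤y = begin
    x * z  ≈⟨ *-comm x z ⟩
    z * x  ≤⟨ *-monoˡ-≤ 0≤z x≤y ⟩
    z * y  ≈⟨ *-comm z y ⟩
    y * z  ∎

  *-mono-≤ : ∀ {w x y z} → 0# ≤ y → 0# ≤ x → w ≤ x → y ≤ z → w * y ≤ x * z
  *-mono-≤ 0≤y 0≤x w≤x y≤z = ≤-trans (*-monoʳ-≤ 0≤y w≤x) (*-monoˡ-≤ 0≤x y≤z)

  0≤1 : 0# ≤ 1#
  0≤1 with total 0# 1#
  ... | inj₁ 0≤1 = 0≤1
  ... | inj₂ 1≤0 = ≤-trans (*-nonneg 0≤-1 0≤-1)
    (≤-reflexive (solve 0 ((:- con (+ 1)) :* (:- con (+ 1)) := con (+ 1)) refl))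
    where 0≤-1 = nonpos⇒neg-nonneg 1≤0

  0≤2 : 0# ≤ 1# + 1#
  0≤2 = +-nonneg 0≤1 0≤1

  0<1 : 0# < 1#
  0<1 = 0≤1 , 0≉1

  <⇒≱ : ∀ {x y} → x < y → ¬ y ≤ x
  <⇒≱ (x≤y , x≉y) y≤x = x≉y (antisym x≤y y≤x)

  ≰⇒< : ∀ {x y} → ¬ x ≤ y → y < x
  ≰⇒< {x} {y} x≰y with total x y
  ... | inj₁ x≤y = ⊥-elim (x≰y x≤y)
  ... | inj₂ y≤x = y≤x , λ y≈x → x≰y (≤-reflexive (sym y≈x))

  <-≤-trans : ∀ {x y z} → x < y → y ≤ z → x < z
  <-≤-trans x<y y≤z = ≤-trans (proj₁ x<y) y≤z , λ x≈z → <⇒≱ x<y (≤-trans y≤z (≤-reflexive (sym x≈z)))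

  +-pos-nonneg : ∀ {x y} → 0# < x → 0# ≤ y → 0# < x + y
  +-pos-nonneg {x} {y} 0<x 0≤y = <-≤-trans 0<x (begin
    x       ≈⟨ +-identityʳ x ⟨
    x + 0#  ≤⟨ +-monoʳ-≤ x 0≤y ⟩
    x + y   ∎)

  inverseʳ : ∀ {x} → 0# < x → x * x ⁻¹ ≈ 1#
  inverseʳ {x} (_ , 0≉x) = *-inverseʳ x (λ x≈0 → 0≉x (sym x≈0))

  cancel-inverse : ∀ {x} y → 0# < x → x ⁻¹ * (x * y) ≈ y
  cancel-inverse {x} y 0<x = begin-equality
    x ⁻¹ * (x * y)  ≈⟨ solve 3 (λ x x⁻¹ y → x⁻¹ :* (x :* y) := (x :* x⁻¹) :* y) refl x (x ⁻¹) y ⟩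
    (x * x ⁻¹) * y  ≈⟨ *-congʳ (inverseʳ 0<x) ⟩
    1# * y          ≈⟨ *-identityˡ y ⟩
    y               ∎

  *-pos : ∀ {x y} → 0# < x → 0# < y → 0# < x * y
  *-pos {x} {y} 0<x 0<y = *-nonneg (proj₁ 0<x) (proj₁ 0<y) , λ 0≈xy → proj₂ 0<y (begin-equality
    0#              ≈⟨ zeroʳ (x ⁻¹) ⟨
    x ⁻¹ * 0#       ≈⟨ *-congˡ 0≈xy ⟩
    x ⁻¹ * (x * y)  ≈⟨ cancel-inverse y 0<x ⟩
    y               ∎)

  ⁻¹-pos : ∀ {x} → 0# < x → 0# < x ⁻¹
  ⁻¹-pos {x} 0<x = ≰⇒< λ x⁻¹≤0 → <⇒≱ 0<1 (begin
    1#        ≈⟨ inverseʳ 0<x ⟨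
    x * x ⁻¹  ≤⟨ *-monoˡ-≤ (proj₁ 0<x) x⁻¹≤0 ⟩
    x * 0#    ≈⟨ zeroʳ x ⟩
    0#        ∎)

  divide-≤ : ∀ {x y z} → 0# < x → x * y ≤ z → y ≤ x ⁻¹ * z
  divide-≤ {x} {y} {z} 0<x xy≤z = begin
    y               ≈⟨ cancel-inverse y 0<x ⟨
    x ⁻¹ * (x * y)  ≤⟨ *-monoˡ-≤ (proj₁ (⁻¹-pos 0<x)) xy≤z ⟩
    x ⁻¹ * z        ∎

  ^-nonneg : ∀ {x} n → 0# ≤ x → 0# ≤ x ^ n
  ^-nonneg zero    0≤x = 0≤1
  ^-nonneg (suc n) 0≤x = *-nonneg 0≤x (^-nonneg n 0≤x)

  ^-pos : ∀ {x} n → 0# < x → 0# < x ^ n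
  ^-pos zero    0<x = 0<1
  ^-pos (suc n) 0<x = *-pos 0<x (^-pos n 0<x)

  ^-antimono : ∀ {x m n} → 0# ≤ x → x ≤ 1# → m ℕ.≤ n → x ^ n ≤ x ^ m
  ^-antimono {n = zero}  0≤x x≤1 ℕ.z≤n = ≤-refl
  ^-antimono {x} {n = suc n} 0≤x x≤1 ℕ.z≤n = begin
    x * x ^ n   ≤⟨ *-mono-≤ (^-nonneg n 0≤x) 0≤1 x≤1 (^-antimono {m = 0} {n} 0≤x x≤1 ℕ.z≤n) ⟩
    1# * 1#     ≈⟨ *-identityˡ 1# ⟩
    1#          ∎
  ^-antimono {m = suc m} {suc n} 0≤x x≤1 (ℕ.s≤s m≤n) = *-monoˡ-≤ 0≤x (^-antimono {m = m} {n} 0≤x x≤1 m≤n)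

  fromℕ-* : ∀ m n → fromℕ (m ℕ.* n) ≈ fromℕ m * fromℕ n
  fromℕ-* = ×1-homo-*

  fromℕ-nonneg : ∀ n → 0# ≤ fromℕ n
  fromℕ-nonneg zero    = ≤-refl
  fromℕ-nonneg (suc n) = +-nonneg 0≤1 (fromℕ-nonneg n)

  fromℕ-pos : ∀ n → 0# < fromℕ (suc n)
  fromℕ-pos n = +-pos-nonneg 0<1 (fromℕ-nonneg n)

  fromℕ-mono : ∀ {m n} → m ℕ.≤ n → fromℕ m ≤ fromℕ n
  fromℕ-mono {n = n} ℕ.z≤n = fromℕ-nonneg n
  fromℕ-mono (ℕ.s≤s m≤n)   = +-monoʳ-≤ 1# (fromℕ-mono m≤n)

  abs-cases : ∀ x → (0# ≤ x × abs x ≈ x) ⊎ (0# ≤ - x × abs x ≈ - x)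
  abs-cases x with total 0# x
  ... | inj₁ 0≤x = inj₁ (0≤x , refl)
  ... | inj₂ x≤0 = inj₂ (nonpos⇒neg-nonneg x≤0 , refl)

  abs-least : ∀ {x b} → x ≤ b → - x ≤ b → abs x ≤ b
  abs-least {x} x≤b -x≤b with total 0# x
  ... | inj₁ _ = x≤b
  ... | inj₂ _ = -x≤b

  private
    -x≤x : ∀ {x} → 0# ≤ x → - x ≤ x
    -x≤x {x} 0≤x = from-nonneg (+-nonneg 0≤x 0≤x) (solve 1 (λ x → x :+ x := x :- (:- x)) refl x)

  x≤abs : ∀ x → x ≤ abs x
  x≤abs x with abs-cases x
  ... | inj₁ (_ , abs≈x)      = ≤-reflexive (sym abs≈x)
  ... | inj₂ (0≤-x , abs≈-x)  = begin
    x        ≈⟨ solve 1 (λ x → x := :- (:- x)) refl x ⟩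
    - (- x)  ≤⟨ -x≤x 0≤-x ⟩
    - x      ≈⟨ abs≈-x ⟨
    abs x    ∎

  -x≤abs : ∀ x → - x ≤ abs x
  -x≤abs x with abs-cases x
  ... | inj₁ (0≤x , abs≈x) = ≤-trans (-x≤x 0≤x) (≤-reflexive (sym abs≈x))
  ... | inj₂ (_ , abs≈-x)  = ≤-reflexive (sym abs≈-x)

  abs-nonneg : ∀ x → 0# ≤ abs x
  abs-nonneg x with abs-cases x
  ... | inj₁ (0≤x , abs≈x)   = ≤-trans 0≤x (≤-reflexive (sym abs≈x))
  ... | inj₂ (0≤-x , abs≈-x) = ≤-trans 0≤-x (≤-reflexive (sym abs≈-x))

  -- `total` need not respect `_≈_`, so `abs` may take different branches at equal arguments. It is
  -- therefore compared through its characterisation as the least upper bound of x and - x.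
  abs-cong : ∀ {x y} → x ≈ y → abs x ≈ abs y
  abs-cong x≈y = antisym (le x≈y) (le (sym x≈y))
    where
    le : ∀ {x y} → x ≈ y → abs x ≤ abs y
    le {x} {y} x≈y = abs-least (≤-trans (≤-reflexive x≈y) (x≤abs y))
                               (≤-trans (≤-reflexive (-‿cong x≈y)) (-x≤abs y))

  abs-of-nonneg : ∀ {x} → 0# ≤ x → abs x ≈ x
  abs-of-nonneg {x} 0≤x = antisym (abs-least ≤-refl (-x≤x 0≤x)) (x≤abs x)

  abs-triangle : ∀ x y → abs (x + y) ≤ abs x + abs y
  abs-triangle x y = abs-least (+-mono-≤ (x≤abs x) (x≤abs y)) (begin
    - (x + y)      ≈⟨ solve 2 (λ x y → :- (x :+ y) := (:- x) :+ (:- y)) refl x y ⟩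
    - x + - y      ≤⟨ +-mono-≤ (-x≤abs x) (-x≤abs y) ⟩
    abs x + abs y  ∎)

  abs-neg : ∀ x → abs (- x) ≤ abs x
  abs-neg x = abs-least (-x≤abs x) (≤-trans (≤-reflexive (solve 1 (λ x → :- (:- x) := x) refl x)) (x≤abs x))

  abs-* : ∀ x y → abs (x * y) ≤ abs x * abs y
  abs-* x y with abs-cases x | abs-cases y
  ... | inj₁ (0≤x , p) | inj₁ (0≤y , q) = begin
    abs (x * y)    ≈⟨ abs-of-nonneg (*-nonneg 0≤x 0≤y) ⟩
    x * y          ≈⟨ *-cong p q ⟨
    abs x * abs y  ∎
  ... | inj₁ (0≤x , p) | inj₂ (0≤-y , q) = begin
    abs (x * y)        ≈⟨ abs-cong (solve 2 (λ x y → x :* y := :- (x :* (:- y))) refl x y) ⟩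
    abs (- (x * - y))  ≤⟨ abs-neg _ ⟩
    abs (x * - y)      ≈⟨ abs-of-nonneg (*-nonneg 0≤x 0≤-y) ⟩
    x * - y            ≈⟨ *-cong p q ⟨
    abs x * abs y      ∎
  ... | inj₂ (0≤-x , p) | inj₁ (0≤y , q) = begin
    abs (x * y)        ≈⟨ abs-cong (solve 2 (λ x y → x :* y := :- ((:- x) :* y)) refl x y) ⟩
    abs (- (- x * y))  ≤⟨ abs-neg _ ⟩
    abs (- x * y)      ≈⟨ abs-of-nonneg (*-nonneg 0≤-x 0≤y) ⟩
    - x * y            ≈⟨ *-cong p q ⟨
    abs x * abs y      ∎
  ... | inj₂ (0≤-x , p) | inj₂ (0≤-y , q) = begin
    abs (x * y)      ≈⟨ abs-cong (solve 2 (λ x y → x :* y := (:- x) :* (:- y)) refl x y) ⟩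
    abs (- x * - y)  ≈⟨ abs-of-nonneg (*-nonneg 0≤-x 0≤-y) ⟩
    - x * - y        ≈⟨ *-cong p q ⟨
    abs x * abs y    ∎

  ∑-mono : ∀ {n} {f g : Vector ℝ n} → (∀ i → f i ≤ g i) → ∑.sum f ≤ ∑.sum g
  ∑-mono {zero}  f≤g = ≤-refl
  ∑-mono {suc n} f≤g = +-mono-≤ (f≤g zero) (∑-mono (λ i → f≤g (suc i)))

  abs-∑ : ∀ {n} (f : Vector ℝ n) → abs (∑.sum f) ≤ ∑.sum (λ i → abs (f i))
  abs-∑ {zero}  f = ≤-reflexive (abs-of-nonneg ≤-refl)
  abs-∑ {suc n} f = ≤-trans (abs-triangle _ _) (+-monoʳ-≤ _ (abs-∑ (λ i → f (suc i))))

  module _ (em : ExcludedMiddle 0ℓ) where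

    -- If the multiples of x were bounded by y they would have a supremum s. Each n x is (n+1) x - x
    -- ≤ s - x, so s - x would be a smaller bound, forcing x ≤ 0.
    archimedean : ∀ {x} → 0# < x → ∀ y → ∃ λ n → y ≤ fromℕ n * x
    archimedean {x} 0<x y with em {∃ λ n → y ≤ fromℕ n * x}
    ... | yes p = p
    ... | no ¬p = ⊥-elim (<⇒≱ 0<x x≤0)
      where
      multiples : ℝ → Set
      multiples z = ∃ λ n → z ≈ fromℕ n * x

      supremum = complete multiples (_ , 0 , refl)
        (y , λ { z (n , z≈) → ≤-trans (≤-reflexive z≈) (proj₁ (≰⇒< (λ y≤ → ¬p (n , y≤)))) })

      s = proj₁ supremum

      s-x-bound : ∀ z → multiples z → z ≤ s - x
      s-x-bound z (n , z≈) = begin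
        z                        ≈⟨ z≈ ⟩
        fromℕ n * x              ≈⟨ solve 2 (λ m x → m :* x := (con (+ 1) :+ m) :* x :- x) refl (fromℕ n) x ⟩
        (1# + fromℕ n) * x - x   ≤⟨ +-monoˡ-≤ (- x) (proj₁ (proj₂ supremum) _ (suc n , refl)) ⟩
        s - x                    ∎

      x≤0 : x ≤ 0#
      x≤0 = from-nonneg (to-nonneg (proj₂ (proj₂ supremum) (s - x) s-x-bound))
        (solve 2 (λ s x → (s :- x) :- s := con (+ 0) :- x) refl s x)

  -- The left side decreases in n: consecutive values differ by (n+1) x² (1-x)ⁿ. This form needs no
  -- division and gives (1-x)ⁿ ≤ 1/3 as soon as n x ≥ 2.
  bernoulli : ∀ {x} → 0# ≤ x → x ≤ 1# → ∀ n → (1# + fromℕ n * x) * (1# - x) ^ n ≤ 1#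
  bernoulli {x} 0≤x x≤1 zero = ≤-reflexive
    (solve 1 (λ x → (con (+ 1) :+ con (+ 0) :* x) :* con (+ 1) := con (+ 1)) refl x)
  bernoulli {x} 0≤x x≤1 (suc n) = begin
    (1# + (1# + N) * x) * ((1# - x) * P)       ≤⟨ from-nonneg
        (*-nonneg (*-nonneg (*-nonneg (fromℕ-nonneg (suc n)) 0≤x) 0≤x) (^-nonneg n (to-nonneg x≤1)))
        (solve 3 (λ N x P → (((con (+ 1) :+ N) :* x) :* x) :* P :=
           (con (+ 1) :+ N :* x) :* P :- (con (+ 1) :+ (con (+ 1) :+ N) :* x) :* ((con (+ 1) :- x) :* P))
         refl N x P) ⟩
    (1# + N * x) * P                           ≤⟨ bernoulli 0≤x x≤1 n ⟩
    1#                                         ∎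
    where
    N = fromℕ n
    P = (1# - x) ^ n

  three : fromℕ 3 ≈ 1# + 1# + 1#
  three = solve 0 (con (+ 1) :+ (con (+ 1) :+ (con (+ 1) :+ con (+ 0))) := con (+ 3)) refl

  ≤⅓ : ∀ {x} → (1# + 1# + 1#) * x ≤ 1# → x ≤ ⅓
  ≤⅓ {x} 3x≤1 = begin
    x         ≤⟨ divide-≤ (fromℕ-pos 2) (≤-trans (≤-reflexive (*-congʳ three)) 3x≤1) ⟩
    ⅓ * 1#    ≈⟨ *-identityʳ ⅓ ⟩
    ⅓         ∎

  small-power : ExcludedMiddle 0ℓ → ∀ {x} → 0# < x → x ≤ 1# → ∃ λ n → (1# - x) ^ n ≤ ⅓
  small-power em {x} 0<x x≤1 = n , ≤⅓ (begin
    (1# + 1# + 1#) * (1# - x) ^ n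
      ≤⟨ *-monoʳ-≤ (^-nonneg n (to-nonneg x≤1)) (begin
           1# + 1# + 1#       ≈⟨ solve 0 (con (+ 3) := con (+ 1) :+ con (+ 2)) refl ⟩
           1# + (1# + 1#)     ≤⟨ +-monoʳ-≤ 1# 2≤nx ⟩
           1# + fromℕ n * x   ∎) ⟩
    (1# + fromℕ n * x) * (1# - x) ^ n
      ≤⟨ bernoulli (proj₁ 0<x) x≤1 n ⟩
    1# ∎)
    where
    n = proj₁ (archimedean em 0<x (1# + 1#))
    2≤nx = proj₂ (archimedean em 0<x (1# + 1#))

-- Separation of convex cones and linear programming duality for a box.

module Duality (em : ExcludedMiddle 0ℓ) (R : RealNumbers) where
  open Vector using (_∷_)
  open OrderedField R
  open SemiringSum semiring using (*-distribˡ-sum)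

  -- `K v r` is to be read as a constraint: the functional sought must be at most r at v. A relation
  -- in place of a sublinear function avoids taking infima.
  record IsConvexCone {n} (K : Vector ℝ n → ℝ → Set) : Set where
    field
      respects : ∀ {v w r s} → (∀ j → v j ≈ w j) → r ≈ s → K v r → K w s
      add      : ∀ {v w r s} → K v r → K w s → K (λ j → v j + w j) (r + s)
      scale    : ∀ {c v r} → 0# < c → K v r → K (λ j → c * v j) (c * r)

  zeros : ∀ {n} → Vector ℝ n
  zeros _ = 0#

  private
    cons-cong : ∀ {n x} {v : Vector ℝ (suc n)} {w} → v zero ≈ x → (∀ j → v (suc j) ≈ w j) →
                ∀ j → v j ≈ (x ∷ w) j
    cons-cong p q zero    = p
    cons-cong p q (suc j) = q j

  -- One step of the Hahn–Banach theorem: the slope a is the least one which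
  -- is compatible with K on the negative half-axis.
  separating-slope : ∀ {n} {K : Vector ℝ (suc n) → ℝ → Set} → IsConvexCone K →
    (∀ v → ∃ (K v)) → (∀ r → K zeros r → 0# ≤ r) →
    ∃ λ a → ∀ t r → K (t ∷ zeros) r → a * t ≤ r
  separating-slope {K = K} cone total-domain nonneg = a , slope
    where
    open IsConvexCone cone
    Lower : ℝ → Set
    Lower x = ∃ λ r → K (- 1# ∷ zeros) r × x ≈ - r

    -- A constraint at 1 and one at -1 add up to a constraint at the zero vector, so every lower
    -- bound for the slope lies below every upper bound.
    balance : ∀ {r s} → K (1# ∷ zeros) r → K (- 1# ∷ zeros) s → - s ≤ r
    balance {r} {s} k l = from-nonneg (nonneg _ (respects
        (λ { zero → solve 0 (con (+ 1) :+ (:- con (+ 1)) := con (+ 0)) refl ; (suc j) → +-identityˡ 0# })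
        refl (add k l)))
      (solve 2 (λ r s → r :+ s := r :- (:- s)) refl r s)

    supremum = complete Lower
      (_ , proj₁ (total-domain (- 1# ∷ zeros)) , proj₂ (total-domain (- 1# ∷ zeros)) , refl)
      (proj₁ (total-domain (1# ∷ zeros)) , λ { x (s , l , x≈) →
        ≤-trans (≤-reflexive x≈) (balance (proj₂ (total-domain (1# ∷ zeros))) l) })

    a = proj₁ supremum

    unscale : ∀ {c t r x} → 0# < c → x * c ≈ t → K (t ∷ zeros) r → K (x ∷ zeros) (c ⁻¹ * r)
    unscale {c} {t} {r} {x} 0<c xc≈t k = respects
      (cons-cong (begin-equality
          c ⁻¹ * t        ≈⟨ *-congˡ xc≈t ⟨
          c ⁻¹ * (x * c)  ≈⟨ *-congˡ (*-comm x c) ⟩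
          c ⁻¹ * (c * x)  ≈⟨ cancel-inverse x 0<c ⟩
          x               ∎)
        (λ j → zeroʳ (c ⁻¹)))
      refl (scale (⁻¹-pos 0<c) k)

    rescale : ∀ {c x r} → 0# < c → x ≤ c ⁻¹ * r → x * c ≤ r
    rescale {c} {x} {r} 0<c x≤ = begin
      x * c           ≤⟨ *-monoʳ-≤ (proj₁ 0<c) x≤ ⟩
      c ⁻¹ * r * c    ≈⟨ solve 3 (λ c d r → d :* r :* c := d :* (c :* r)) refl c (c ⁻¹) r ⟩
      c ⁻¹ * (c * r)  ≈⟨ cancel-inverse r 0<c ⟩
      r               ∎

    -- By homogeneity only t = 0, 1 and -1 matter. At 1 the bound holds because a is the least upper
    -- bound of `Lower`, at -1 because a is an upper bound.
    slope : ∀ t r → K (t ∷ zeros) r → a * t ≤ r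
    slope t r k with em {0# ≈ t}
    ... | yes 0≈t = begin
      a * t   ≈⟨ *-congˡ 0≈t ⟨
      a * 0#  ≈⟨ zeroʳ a ⟩
      0#      ≤⟨ nonneg r (respects (λ { zero → sym 0≈t ; (suc j) → refl }) refl k) ⟩
      r       ∎
    ... | no 0≉t with total 0# t
    ...   | inj₁ 0≤t = rescale 0<t (proj₂ (proj₂ supremum) _ λ { x (s , l , x≈) →
              ≤-trans (≤-reflexive x≈) (balance (unscale 0<t (*-identityˡ t) k) l) })
            where 0<t = 0≤t , 0≉t
    ...   | inj₂ t≤0 = begin
            a * t        ≈⟨ solve 2 (λ a t → a :* t := (:- a) :* (:- t)) refl a t ⟩
            - a * - t    ≤⟨ rescale 0<-t (begin
                              - a                     ≤⟨ neg-mono (proj₁ (proj₂ supremum) _ (_ , unscale 0<-t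
                                                           (solve 1 (λ t → (:- con (+ 1)) :* (:- t) := t) refl t) k , refl)) ⟩
                              - (- ((- t) ⁻¹ * r))    ≈⟨ solve 1 (λ x → :- (:- x) := x) refl _ ⟩
                              (- t) ⁻¹ * r            ∎) ⟩
            r            ∎
            where
            0<-t : 0# < - t
            0<-t = nonpos⇒neg-nonneg t≤0 , λ 0≈-t → 0≉t (begin-equality
              0#        ≈⟨ solve 0 (con (+ 0) := :- con (+ 0)) refl ⟩
              - 0#      ≈⟨ -‿cong 0≈-t ⟩
              - (- t)   ≈⟨ solve 1 (λ x → :- (:- x) := x) refl t ⟩
              t         ∎)

  -- Induction on the dimension: once the slope a₀ on the first axis is fixed, the cone is sheared
  -- by a₀ and the first coordinate is projected away. The inequality for the slope is exactly
  -- nonnegativity of the projected cone `K′` over the zero vector.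
  separation : ∀ n {K : Vector ℝ n → ℝ → Set} → IsConvexCone K →
    (∀ v → ∃ (K v)) → (∀ r → K zeros r → 0# ≤ r) →
    ∃ λ (a : Vector ℝ n) → ∀ v r → K v r → ∑.sum (λ j → a j * v j) ≤ r
  separation zero cone total-domain nonneg =
    (λ ()) , λ v r k → nonneg r (IsConvexCone.respects cone (λ ()) refl k)
  separation (suc n) {K} cone total-domain nonneg = a₀ ∷ a , λ v r k → begin
      a₀ * v zero + ∑.sum (λ j → a j * v (suc j))
        ≤⟨ +-monoʳ-≤ _ (proj₂ rest (λ j → v (suc j)) (r - a₀ * v zero)
             (v zero , respects (cons-cong refl (λ _ → refl))
                (solve 2 (λ r y → r := (r :- y) :+ y) refl r (a₀ * v zero)) k)) ⟩
      a₀ * v zero + (r - a₀ * v zero)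
        ≈⟨ solve 2 (λ r y → y :+ (r :- y) := r) refl r (a₀ * v zero) ⟩
      r ∎
    where
    open IsConvexCone cone
    a₀ = proj₁ (separating-slope cone total-domain nonneg)
    slope = proj₂ (separating-slope cone total-domain nonneg)

    K′ : Vector ℝ n → ℝ → Set
    K′ v r = ∃ λ t → K (t ∷ v) (r + a₀ * t)

    cone′ : IsConvexCone K′
    cone′ = record
      { respects = λ v≈w r≈s (t , k) → t , respects (cons-cong refl v≈w) (+-congʳ r≈s) k
      ; add      = λ { {r = r} {s} (t , k) (u , l) → t + u , respects (cons-cong refl (λ _ → refl))
                       (solve 5 (λ r s a t u → r :+ a :* t :+ (s :+ a :* u) := r :+ s :+ a :* (t :+ u)) refl r s a₀ t u)
                       (add k l) }
      ; scale    = λ { {c} {r = r} 0<c (t , k) → c * t , respects (cons-cong refl (λ _ → refl))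
                       (solve 4 (λ c r a t → c :* (r :+ a :* t) := c :* r :+ a :* (c :* t)) refl c r a₀ t)
                       (scale 0<c k) }
      }

    rest = separation n cone′
      (λ v → let r , k = total-domain (0# ∷ v) in
        r , 0# , respects (λ _ → refl) (solve 2 (λ r a → r := r :+ a :* con (+ 0)) refl r a₀) k)
      (λ r (t , k) → from-nonneg (to-nonneg (slope t _ k))
        (solve 2 (λ r y → (r :+ y) :- y := r :- con (+ 0)) refl r (a₀ * t)))
    a = proj₁ rest

  record IsSubspace {n} (W : Vector ℝ n → Set) : Set where
    field
      respects : ∀ {v w} → (∀ j → v j ≈ w j) → W v → W w
      zero∈    : W zeros
      add      : ∀ {v w} → W v → W w → W (λ j → v j + w j)
      scale    : ∀ c {v} → W v → W (λ j → c * v j)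

  term≤∑ : ∀ {n} (f : Vector ℝ n) → (∀ j → 0# ≤ f j) → ∀ i → f i ≤ ∑.sum f
  term≤∑ f 0≤f zero = begin
    f zero       ≈⟨ +-identityʳ _ ⟨
    f zero + 0#  ≤⟨ +-monoʳ-≤ _ (∑-nonneg (λ j → 0≤f (suc j))) ⟩
    ∑.sum f      ∎
    where
    ∑-nonneg : ∀ {n} {f : Vector ℝ n} → (∀ j → 0# ≤ f j) → 0# ≤ ∑.sum f
    ∑-nonneg {zero}  0≤f = ≤-refl
    ∑-nonneg {suc n} 0≤f = +-nonneg (0≤f zero) (∑-nonneg (λ j → 0≤f (suc j)))
  term≤∑ f 0≤f (suc i) = begin
    f (suc i)                            ≤⟨ term≤∑ (λ j → f (suc j)) (λ j → 0≤f (suc j)) i ⟩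
    ∑.sum (λ j → f (suc j))              ≈⟨ +-identityˡ _ ⟨
    0# + ∑.sum (λ j → f (suc j))         ≤⟨ +-monoˡ-≤ _ (0≤f zero) ⟩
    ∑.sum f                              ∎

  -- The functional separating `K` is at most 0 on W, hence zero there, at most -1 at - t and at
  -- most 1 on the box centred at the origin. Evaluating it at the corner of that box with the signs
  -- of a turns the last bound into the weighted norm.
  box-duality : ∀ {n} {W : Vector ℝ n → Set} → IsSubspace W →
    (t ρ : Vector ℝ n) → (∀ j → 0# < ρ j) →
    ¬ (∃ λ w → W w × ∀ j → abs (t j - w j) ≤ ρ j) →
    ∃ λ (a : Vector ℝ n) →
      (∀ w → W w → ∑.sum (λ j → a j * w j) ≈ 0#) ×
      ∑.sum (λ j → abs (a j) * ρ j) ≤ 1# ×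
      1# ≤ ∑.sum (λ j → a j * t j)
  box-duality {n} {W} subspace t ρ 0<ρ infeasible = a , orthogonal , norm , correlation
    where
    module W = IsSubspace subspace

    -- The cone spanned by W × {0}, by (- t , - 1) and by the box × {1}.
    record K (v : Vector ℝ n) (r : ℝ) : Set where
      field
        w b   : Vector ℝ n
        s l   : ℝ
        w∈W   : W w
        0≤s   : 0# ≤ s
        0≤l   : 0# ≤ l
        b≤    : ∀ j → abs (b j) ≤ l * ρ j
        v≈    : ∀ j → v j ≈ w j - s * t j + b j
        r≈    : r ≈ l - s

    K-respects : ∀ {v w r s} → (∀ j → v j ≈ w j) → r ≈ s → K v r → K w s
    K-respects v≈w r≈s k = record
      { w∈W = w∈W ; 0≤s = 0≤s ; 0≤l = 0≤l ; b≤ = b≤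
      ; v≈ = λ j → trans (sym (v≈w j)) (v≈ j) ; r≈ = trans (sym r≈s) r≈ }
      where open K k

    K-add : ∀ {v w r s} → K v r → K w s → K (λ j → v j + w j) (r + s)
    K-add k k′ = record
      { w = λ j → A.w j + B.w j ; b = λ j → A.b j + B.b j ; s = A.s + B.s ; l = A.l + B.l
      ; w∈W = W.add A.w∈W B.w∈W ; 0≤s = +-nonneg A.0≤s B.0≤s ; 0≤l = +-nonneg A.0≤l B.0≤l
      ; b≤ = λ j → begin
          abs (A.b j + B.b j)        ≤⟨ abs-triangle _ _ ⟩
          abs (A.b j) + abs (B.b j)  ≤⟨ +-mono-≤ (A.b≤ j) (B.b≤ j) ⟩
          A.l * ρ j + B.l * ρ j      ≈⟨ solve 3 (λ x y z → x :* z :+ y :* z := (x :+ y) :* z) refl A.l B.l (ρ j) ⟩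
          (A.l + B.l) * ρ j          ∎
      ; v≈ = λ j → trans (+-cong (A.v≈ j) (B.v≈ j))
          (solve 7 (λ w s b w′ s′ b′ t → w :- s :* t :+ b :+ (w′ :- s′ :* t :+ b′) :=
                                         w :+ w′ :- (s :+ s′) :* t :+ (b :+ b′)) refl
             (A.w j) A.s (A.b j) (B.w j) B.s (B.b j) (t j))
      ; r≈ = trans (+-cong A.r≈ B.r≈)
          (solve 4 (λ l s l′ s′ → l :- s :+ (l′ :- s′) := l :+ l′ :- (s :+ s′)) refl A.l A.s B.l B.s) }
      where
      module A = K k
      module B = K k′

    K-scale : ∀ {c v r} → 0# < c → K v r → K (λ j → c * v j) (c * r)
    K-scale {c} 0<c k = record
      { w = λ j → c * w j ; b = λ j → c * b j ; s = c * s ; l = c * l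
      ; w∈W = W.scale c w∈W ; 0≤s = *-nonneg (proj₁ 0<c) 0≤s ; 0≤l = *-nonneg (proj₁ 0<c) 0≤l
      ; b≤ = λ j → begin
          abs (c * b j)      ≤⟨ abs-* c (b j) ⟩
          abs c * abs (b j)  ≈⟨ *-congʳ (abs-of-nonneg (proj₁ 0<c)) ⟩
          c * abs (b j)      ≤⟨ *-monoˡ-≤ (proj₁ 0<c) (b≤ j) ⟩
          c * (l * ρ j)      ≈⟨ *-assoc c l (ρ j) ⟨
          c * l * ρ j        ∎
      ; v≈ = λ j → trans (*-congˡ (v≈ j))
          (solve 5 (λ c w s t b → c :* (w :- s :* t :+ b) := c :* w :- c :* s :* t :+ c :* b) refl
             c (w j) s (t j) (b j))
      ; r≈ = trans (*-congˡ r≈) (solve 3 (λ c l s → c :* (l :- s) := c :* l :- c :* s) refl c l s) }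
      where open K k

    cone : IsConvexCone K
    cone = record { respects = K-respects ; add = K-add ; scale = K-scale }

    total-domain : ∀ v → ∃ (K v)
    total-domain v = _ , record
      { w = zeros ; b = v ; s = 0# ; l = l
      ; w∈W = W.zero∈ ; 0≤s = ≤-refl ; 0≤l = ≤-trans (abs-nonneg 0#) abs0≤l
      ; b≤ = λ j → begin
          abs (v j)                   ≈⟨ cancel-inverse _ (0<ρ j) ⟨
          ρ j ⁻¹ * (ρ j * abs (v j))  ≈⟨ solve 3 (λ x y z → x :* (y :* z) := z :* x :* y) refl (ρ j ⁻¹) (ρ j) (abs (v j)) ⟩
          abs (v j) * ρ j ⁻¹ * ρ j    ≤⟨ *-monoʳ-≤ (proj₁ (0<ρ j)) (l-term j) ⟩
          l * ρ j                     ∎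
      ; v≈ = λ j → solve 2 (λ v t → v := con (+ 0) :- con (+ 0) :* t :+ v) refl (v j) (t j)
      ; r≈ = refl }
      where
      terms : Vector ℝ n
      terms j = abs (v j) * ρ j ⁻¹
      0≤terms : ∀ j → 0# ≤ terms j
      0≤terms j = *-nonneg (abs-nonneg _) (proj₁ (⁻¹-pos (0<ρ j)))
      -- Summing dominates every |v j| / ρ j, so v lies in l times the box.
      l = ∑.sum terms
      l-term = term≤∑ terms 0≤terms
      abs0≤l : abs 0# ≤ l
      abs0≤l = begin
        abs 0#                          ≈⟨ abs-of-nonneg ≤-refl ⟩
        0#                              ≤⟨ abs-nonneg _ ⟩
        abs l                           ≤⟨ abs-∑ terms ⟩
        ∑.sum (λ j → abs (terms j))     ≈⟨ ∑.sum-cong-≋ (λ j → abs-of-nonneg (0≤terms j)) ⟩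
        l                               ∎

    -- A negative r = l - s gives s > 0 and l ≤ s. Dividing 0 = w - s t + b by s then shows that w /
    -- s is a point of W in the box around t.
    nonneg : ∀ r → K zeros r → 0# ≤ r
    nonneg r k with em {0# ≤ r}
    ... | yes 0≤r = 0≤r
    ... | no  0≰r = ⊥-elim (infeasible ((λ j → s ⁻¹ * w j) , W.scale (s ⁻¹) w∈W , close))
      where
      open K k
      l≤s : l ≤ s
      l≤s = from-nonneg (nonpos⇒neg-nonneg (proj₁ (≰⇒< 0≰r)))
        (trans (-‿cong r≈) (solve 2 (λ l s → :- (l :- s) := s :- l) refl l s))
      0<s : 0# < s
      0<s = 0≤s , λ 0≈s → 0≰r (begin
        0#      ≤⟨ 0≤l ⟩
        l       ≈⟨ solve 1 (λ l → l := l :- con (+ 0)) refl l ⟩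
        l - 0#  ≈⟨ +-congˡ (-‿cong 0≈s) ⟩
        l - s   ≈⟨ r≈ ⟨
        r       ∎)
      close : ∀ j → abs (t j - s ⁻¹ * w j) ≤ ρ j
      close j = begin
        abs (t j - s ⁻¹ * w j)                ≈⟨ abs-cong (begin-equality
            t j - s ⁻¹ * w j                    ≈⟨ +-congʳ (cancel-inverse (t j) 0<s) ⟨
            s ⁻¹ * (s * t j) - s ⁻¹ * w j       ≈⟨ solve 5 (λ i s t w b → i :* (s :* t) :- i :* w :=
                                                     i :* b :- i :* (w :- s :* t :+ b)) refl (s ⁻¹) s (t j) (w j) (b j) ⟩
            s ⁻¹ * b j - s ⁻¹ * (w j - s * t j + b j) ≈⟨ +-congˡ (-‿cong (*-congˡ (v≈ j))) ⟨
            s ⁻¹ * b j - s ⁻¹ * 0#              ≈⟨ solve 2 (λ i b → i :* b :- i :* con (+ 0) := i :* b) refl (s ⁻¹) (b j) ⟩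
            s ⁻¹ * b j                          ∎) ⟩
        abs (s ⁻¹ * b j)                      ≤⟨ abs-* _ _ ⟩
        abs (s ⁻¹) * abs (b j)                ≈⟨ *-congʳ (abs-of-nonneg 0≤s⁻¹) ⟩
        s ⁻¹ * abs (b j)                      ≤⟨ *-monoˡ-≤ 0≤s⁻¹ (b≤ j) ⟩
        s ⁻¹ * (l * ρ j)                      ≤⟨ *-monoˡ-≤ 0≤s⁻¹ (*-monoʳ-≤ (proj₁ (0<ρ j)) l≤s) ⟩
        s ⁻¹ * (s * ρ j)                      ≈⟨ cancel-inverse (ρ j) 0<s ⟩
        ρ j                                   ∎
        where 0≤s⁻¹ = proj₁ (⁻¹-pos 0<s)

    separated = separation n cone total-domain nonneg
    a = proj₁ separated

    abs0≤ : ∀ {x} → 0# ≤ x → abs 0# ≤ x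
    abs0≤ 0≤x = ≤-trans (≤-reflexive (abs-of-nonneg ≤-refl)) 0≤x

    ∑-negate : ∀ w → ∑.sum (λ j → a j * (- 1# * w j)) ≈ - ∑.sum (λ j → a j * w j)
    ∑-negate w = begin-equality
      ∑.sum (λ j → a j * (- 1# * w j))  ≈⟨ ∑.sum-cong-≋ (λ j →
        solve 2 (λ a w → a :* ((:- con (+ 1)) :* w) := (:- con (+ 1)) :* (a :* w)) refl (a j) (w j)) ⟩
      ∑.sum (λ j → - 1# * (a j * w j))  ≈⟨ *-distribˡ-sum (- 1#) (λ j → a j * w j) ⟨
      - 1# * ∑.sum (λ j → a j * w j)    ≈⟨ solve 1 (λ x → (:- con (+ 1)) :* x := :- x) refl _ ⟩
      - ∑.sum (λ j → a j * w j)         ∎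

    from-W : ∀ w → W w → ∑.sum (λ j → a j * w j) ≤ 0#
    from-W w w∈W = proj₂ separated w 0# record
      { w = w ; b = zeros ; s = 0# ; l = 0# ; w∈W = w∈W ; 0≤s = ≤-refl ; 0≤l = ≤-refl
      ; b≤ = λ j → abs0≤ (≤-reflexive (sym (zeroˡ _)))
      ; v≈ = λ j → solve 2 (λ w t → w := w :- con (+ 0) :* t :+ con (+ 0)) refl (w j) (t j)
      ; r≈ = solve 0 (con (+ 0) := con (+ 0) :- con (+ 0)) refl }

    orthogonal : ∀ w → W w → ∑.sum (λ j → a j * w j) ≈ 0#
    orthogonal w w∈W = antisym (from-W w w∈W) (from-nonneg (to-nonneg (from-W _ (W.scale (- 1#) w∈W))) (begin-equality
      0# - ∑.sum (λ j → a j * (- 1# * w j))  ≈⟨ +-congˡ (-‿cong (∑-negate w)) ⟩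
      0# - - ∑.sum (λ j → a j * w j)         ≈⟨ solve 1 (λ x → con (+ 0) :- (:- x) := x :- con (+ 0)) refl _ ⟩
      ∑.sum (λ j → a j * w j) - 0#           ∎))

    sign-of : ∀ x → ∃ λ σ → abs σ ≤ 1# × x * σ ≈ abs x
    sign-of x with abs-cases x
    ... | inj₁ (_ , abs≈x)  = 1# , ≤-reflexive (abs-of-nonneg 0≤1) , trans (*-identityʳ x) (sym abs≈x)
    ... | inj₂ (_ , abs≈-x) = - 1# , ≤-trans (abs-neg 1#) (≤-reflexive (abs-of-nonneg 0≤1)) ,
      trans (solve 1 (λ x → x :* (:- con (+ 1)) := :- x) refl x) (sym abs≈-x)

    norm : ∑.sum (λ j → abs (a j) * ρ j) ≤ 1#
    norm = begin
      ∑.sum (λ j → abs (a j) * ρ j)  ≈⟨ ∑.sum-cong-≋ (λ j → trans (*-congʳ (sym (proj₂ (proj₂ (sign-of (a j)))))) (*-assoc _ _ _)) ⟩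
      ∑.sum (λ j → a j * (σ j * ρ j)) ≤⟨ proj₂ separated _ 1# record
        { w = zeros ; b = λ j → σ j * ρ j ; s = 0# ; l = 1# ; w∈W = W.zero∈ ; 0≤s = ≤-refl ; 0≤l = 0≤1
        ; b≤ = λ j → begin
            abs (σ j * ρ j)      ≤⟨ abs-* _ _ ⟩
            abs (σ j) * abs (ρ j) ≤⟨ *-monoʳ-≤ (abs-nonneg _) (proj₁ (proj₂ (sign-of (a j)))) ⟩
            1# * abs (ρ j)       ≈⟨ *-congˡ (abs-of-nonneg (proj₁ (0<ρ j))) ⟩
            1# * ρ j             ∎
        ; v≈ = λ j → solve 2 (λ v t → v := con (+ 0) :- con (+ 0) :* t :+ v) refl (σ j * ρ j) (t j)
        ; r≈ = solve 0 (con (+ 1) := con (+ 1) :- con (+ 0)) refl } ⟩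
      1# ∎
      where
      σ : Vector ℝ n
      σ j = proj₁ (sign-of (a j))

    correlation : 1# ≤ ∑.sum (λ j → a j * t j)
    correlation = from-nonneg (to-nonneg (proj₂ separated (λ j → - 1# * t j) (- 1#) record
        { w = zeros ; b = zeros ; s = 1# ; l = 0# ; w∈W = W.zero∈ ; 0≤s = 0≤1 ; 0≤l = ≤-refl
        ; b≤ = λ j → abs0≤ (≤-reflexive (sym (zeroˡ _)))
        ; v≈ = λ j → solve 1 (λ t → (:- con (+ 1)) :* t := con (+ 0) :- con (+ 1) :* t :+ con (+ 0)) refl (t j)
        ; r≈ = solve 0 (:- con (+ 1) := con (+ 0) :- con (+ 1)) refl }))
      (begin-equality
        - 1# - ∑.sum (λ j → a j * (- 1# * t j))  ≈⟨ +-congˡ (-‿cong (∑-negate t)) ⟩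
        - 1# - - ∑.sum (λ j → a j * t j)         ≈⟨ solve 1 (λ x → (:- con (+ 1)) :- (:- x) := x :- con (+ 1)) refl _ ⟩
        ∑.sum (λ j → a j * t j) - 1#             ∎)

-- Evaluation and degree of formal polynomials.

module Polynomials (R : RealNumbers) where
  open Lists using ([]; _∷_; _++_)
  open Alls using ([]; _∷_)
  open OrderedField R
  open ApproximateDegree R public

  monomial : ∀ {N} → Vector ℕ N → Point N → ℝ
  monomial α x = ∏.sum (λ j → x j ^ α j)

  monomial-+ : ∀ {N} (α β : Vector ℕ N) x →
               monomial (λ j → α j ℕ.+ β j) x ≈ monomial α x * monomial β x
  monomial-+ α β x = begin-equality
    ∏.sum (λ j → x j ^ (α j ℕ.+ β j))      ≈⟨ ∏.sum-cong-≋ (λ j → ^-homo-* (x j) (α j) (β j)) ⟩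
    ∏.sum (λ j → x j ^ α j * x j ^ β j)    ≈⟨ ∏.∑-distrib-+ (λ j → x j ^ α j) (λ j → x j ^ β j) ⟩
    monomial α x * monomial β x            ∎

  monomial-cong : ∀ {N} (α : Vector ℕ N) {x y} → x ≋ y → monomial α x ≈ monomial α y
  monomial-cong α x≋y = ∏.sum-cong-≋ (λ j → ^-congˡ (α j) (x≋y j))

  eval-cong : ∀ {N} (p : Polynomial N) {x y} → x ≋ y → eval p x ≈ eval p y
  eval-cong []            x≋y = refl
  eval-cong ((c , α) ∷ p) x≋y = +-cong (*-congˡ (monomial-cong α x≋y)) (eval-cong p x≋y)

  eval-++ : ∀ {N} (p q : Polynomial N) x → eval (p ++ q) x ≈ eval p x + eval q x
  eval-++ []            q x = sym (+-identityˡ _)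
  eval-++ ((c , α) ∷ p) q x = begin-equality
    c * monomial α x + eval (p ++ q) x         ≈⟨ +-congˡ (eval-++ p q x) ⟩
    c * monomial α x + (eval p x + eval q x)   ≈⟨ solve 3 (λ x y z → x :+ (y :+ z) := x :+ y :+ z) refl _ _ _ ⟩
    c * monomial α x + eval p x + eval q x     ∎

  scale : ∀ {N} → ℝ → Polynomial N → Polynomial N
  scale c = Lists.map (λ (d , α) → c * d , α)

  eval-scale : ∀ {N} c (p : Polynomial N) x → eval (scale c p) x ≈ c * eval p x
  eval-scale c []            x = sym (zeroʳ c)
  eval-scale c ((d , α) ∷ p) x = begin-equality
    c * d * monomial α x + eval (scale c p) x   ≈⟨ +-congˡ (eval-scale c p x) ⟩
    c * d * monomial α x + c * eval p x         ≈⟨ solve 4 (λ c d m e → c :* d :* m :+ c :* e := c :* (d :* m :+ e)) refl c d _ _ ⟩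
    c * (d * monomial α x + eval p x)           ∎

  infixl 7 _·_
  _·_ : ∀ {N} → Polynomial N → Polynomial N → Polynomial N
  []            · q = []
  ((c , α) ∷ p) · q = Lists.map (λ (d , β) → c * d , λ j → α j ℕ.+ β j) q ++ p · q

  eval-· : ∀ {N} (p q : Polynomial N) x → eval (p · q) x ≈ eval p x * eval q x
  eval-· []            q x = sym (zeroˡ _)
  eval-· ((c , α) ∷ p) q x = begin-equality
    eval (shift q ++ p · q) x                          ≈⟨ eval-++ (shift q) (p · q) x ⟩
    eval (shift q) x + eval (p · q) x                  ≈⟨ +-cong (eval-shift q) (eval-· p q x) ⟩
    c * monomial α x * eval q x + eval p x * eval q x  ≈⟨ solve 3 (λ x y z → x :* z :+ y :* z := (x :+ y) :* z) refl _ _ _ ⟩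
    (c * monomial α x + eval p x) * eval q x           ∎
    where
    shift = Lists.map (λ (d , β) → c * d , λ j → α j ℕ.+ β j)
    eval-shift : ∀ q → eval (shift q) x ≈ c * monomial α x * eval q x
    eval-shift []            = sym (zeroʳ _)
    eval-shift ((d , β) ∷ q) = begin-equality
      c * d * monomial (λ j → α j ℕ.+ β j) x + eval (shift q) x
        ≈⟨ +-cong (*-congˡ (monomial-+ α β x)) (eval-shift q) ⟩
      c * d * (monomial α x * monomial β x) + c * monomial α x * eval q x
        ≈⟨ solve 5 (λ c d m n e → c :* d :* (m :* n) :+ c :* m :* e := c :* m :* (d :* n :+ e)) refl c d _ _ _ ⟩
      c * monomial α x * (d * monomial β x + eval q x) ∎

  degree-mono : ∀ {N d e} {p : Polynomial N} → d ℕ.≤ e → DegreeAtMost d p → DegreeAtMost e p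
  degree-mono d≤e = Alls.map (λ ≤d → ℕ.≤-trans ≤d d≤e)

  degree-scale : ∀ {N d c} {p : Polynomial N} → DegreeAtMost d p → DegreeAtMost d (scale c p)
  degree-scale = AllP.map⁺

  degree-· : ∀ {N d e} {p q : Polynomial N} →
             DegreeAtMost d p → DegreeAtMost e q → DegreeAtMost (d ℕ.+ e) (p · q)
  degree-·                    []                _  = []
  degree-· {p = (c , α) ∷ _} (α≤d ∷ p≤d) q≤e = AllP.++⁺
    (AllP.map⁺ (Alls.map (λ { {_ , β} β≤e →
      ℕ.≤-trans (ℕ.≤-reflexive (∑ℕ.∑-distrib-+ α β)) (ℕ.+-mono-≤ α≤d β≤e) }) q≤e))
    (degree-· p≤d q≤e)

-- Iterating t ↦ (3t - t³)/2, whose attracting fixed points are ±1, turns a weak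
-- approximation into one with error ⅓.
module ErrorReduction (em : ExcludedMiddle 0ℓ) (R : RealNumbers) where
  open Lists using (_++_)
  open OrderedField R
  open Polynomials R

  ½ : ℝ
  ½ = (1# + 1#) ⁻¹

  0<½ : 0# < ½
  0<½ = ⁻¹-pos (+-pos-nonneg 0<1 0≤1)

  0≤½ : 0# ≤ ½
  0≤½ = proj₁ 0<½

  2*½ : (1# + 1#) * ½ ≈ 1#
  2*½ = inverseʳ (+-pos-nonneg 0<1 0≤1)

  step : ℝ → ℝ
  step t = ½ * (1# + 1# + 1#) * t + - ½ * (t * (t * t))

  -- The initial halving brings values from [-2,2] into [-1,1], an interval that `step` preserves; a
  -- value that was at least δ becomes at least δ/2.
  amplify : ℕ → ℝ → ℝ
  amplify zero    t = ½ * t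
  amplify (suc k) t = step (amplify k t)

  step-cong : ∀ {s t} → s ≈ t → step s ≈ step t
  step-cong s≈t = +-cong (*-congˡ s≈t) (*-congˡ (*-cong s≈t (*-cong s≈t s≈t)))

  step-odd : ∀ t → step (- t) ≈ - step t
  step-odd t = solve 2 (λ h t → h :* con (+ 3) :* (:- t) :+ (:- h) :* ((:- t) :* ((:- t) :* (:- t))) :=
    :- (h :* con (+ 3) :* t :+ (:- h) :* (t :* (t :* t)))) refl ½ t

  amplify-odd : ∀ k t → amplify k (- t) ≈ - amplify k t
  amplify-odd zero    t = solve 2 (λ h t → h :* (:- t) := :- (h :* t)) refl ½ t
  amplify-odd (suc k) t = trans (step-cong (amplify-odd k t)) (step-odd (amplify k t))

  -- The square comes from 1 being a critical fixed point of `step`. Both the invariance of [-1,1]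
  -- and the contraction towards 1 are read off from this factorisation.
  1-step : ∀ t → 1# - step t ≈ ½ * ((1# - t) * (1# - t) * (1# + 1# + t))
  1-step t = begin-equality
    1# - step t                                  ≈⟨ +-congʳ 2*½ ⟨
    (1# + 1#) * ½ - step t                       ≈⟨ solve 2 (λ h t →
        con (+ 2) :* h :- (h :* con (+ 3) :* t :+ (:- h) :* (t :* (t :* t))) :=
        h :* ((con (+ 1) :- t) :* (con (+ 1) :- t) :* (con (+ 2) :+ t))) refl ½ t ⟩
    ½ * ((1# - t) * (1# - t) * (1# + 1# + t))    ∎

  step≤1 : ∀ {t} → t ≤ 1# → - t ≤ 1# → step t ≤ 1#
  step≤1 {t} t≤1 -t≤1 = from-nonneg
    (*-nonneg 0≤½ (*-nonneg (*-nonneg (to-nonneg t≤1) (to-nonneg t≤1)) (+-nonneg 0≤1 (to-nonneg -t≤1))))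
    (trans (solve 2 (λ h t → h :* ((con (+ 1) :- t) :* (con (+ 1) :- t) :* (con (+ 1) :+ (con (+ 1) :- (:- t)))) :=
                             h :* ((con (+ 1) :- t) :* (con (+ 1) :- t) :* (con (+ 2) :+ t))) refl ½ t)
           (sym (1-step t)))

  halve : ∀ {t} → t ≤ 1# + 1# → ½ * t ≤ 1#
  halve {t} t≤2 = begin
    ½ * t           ≤⟨ *-monoˡ-≤ 0≤½ t≤2 ⟩
    ½ * (1# + 1#)   ≈⟨ *-comm _ _ ⟩
    (1# + 1#) * ½   ≈⟨ 2*½ ⟩
    1#              ∎

  amplify≤1 : ∀ k {t} → t ≤ 1# + 1# → - t ≤ 1# + 1# → amplify k t ≤ 1#
  -amplify≤1 : ∀ k {t} → t ≤ 1# + 1# → - t ≤ 1# + 1# → - amplify k t ≤ 1#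

  amplify≤1 zero    t≤2 -t≤2 = halve t≤2
  amplify≤1 (suc k) t≤2 -t≤2 = step≤1 (amplify≤1 k t≤2 -t≤2) (-amplify≤1 k t≤2 -t≤2)

  -amplify≤1 k {t} t≤2 -t≤2 = begin
    - amplify k t    ≈⟨ amplify-odd k t ⟨
    amplify k (- t)  ≤⟨ neg-amplify k ⟩
    1#               ∎
    where
    neg-amplify : ∀ k → amplify k (- t) ≤ 1#
    neg-amplify zero    = halve -t≤2
    neg-amplify (suc k) = step≤1 (neg-amplify k) (begin
      - amplify k (- t)    ≈⟨ -‿cong (amplify-odd k t) ⟩
      - (- amplify k t)    ≈⟨ solve 1 (λ x → :- (:- x) := x) refl _ ⟩
      amplify k t          ≤⟨ amplify≤1 k t≤2 -t≤2 ⟩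
      1#                   ∎)

  -- Since step t - t = t (1-t)(1+t)/2 is nonnegative on [0,1], a lower bound survives all
  -- iterations and the contraction factor stays fixed.
  step-increases : ∀ {η t} → 0# ≤ η → η ≤ t → t ≤ 1# → η ≤ step t
  step-increases {η} {t} 0≤η η≤t t≤1 = ≤-trans η≤t (from-nonneg
    (*-nonneg 0≤½ (*-nonneg (*-nonneg 0≤t (to-nonneg t≤1)) (+-nonneg 0≤1 0≤t)))
    (begin-equality
      ½ * (t * (1# - t) * (1# + t))     ≈⟨ solve 2 (λ h t → h :* (t :* (con (+ 1) :- t) :* (con (+ 1) :+ t)) :=
          (h :* con (+ 3) :* t :+ (:- h) :* (t :* (t :* t))) :- (con (+ 2) :* h) :* t) refl ½ t ⟩
      step t - (1# + 1#) * ½ * t        ≈⟨ +-congˡ (-‿cong (*-congʳ 2*½)) ⟩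
      step t - 1# * t                   ≈⟨ +-congˡ (-‿cong (*-identityˡ t)) ⟩
      step t - t                        ∎))
    where 0≤t = ≤-trans 0≤η η≤t

  -- Here 1 - step t = (1-t)(1 - (t + t²)/2), and t ≥ η. A linear rate is enough because the number
  -- of iterations need only be independent of g.
  step-contracts : ∀ {η t} → 0# ≤ η → η ≤ t → t ≤ 1# → 1# - step t ≤ (1# - ½ * η) * (1# - t)
  step-contracts {η} {t} 0≤η η≤t t≤1 = from-nonneg
    (*-nonneg 0≤½ (*-nonneg (to-nonneg t≤1) (+-nonneg (to-nonneg η≤t) (*-nonneg 0≤t 0≤t))))
    (begin-equality
      ½ * ((1# - t) * (t - η + t * t))
        ≈⟨ solve 3 (λ h t η → h :* ((con (+ 1) :- t) :* (t :- η :+ t :* t)) :=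
             (con (+ 2) :* h :- h :* η) :* (con (+ 1) :- t) :-
             h :* ((con (+ 1) :- t) :* (con (+ 1) :- t) :* (con (+ 2) :+ t))) refl ½ t η ⟩
      ((1# + 1#) * ½ - ½ * η) * (1# - t) - ½ * ((1# - t) * (1# - t) * (1# + 1# + t))
        ≈⟨ +-cong (*-congʳ (+-congʳ 2*½)) (-‿cong (sym (1-step t))) ⟩
      (1# - ½ * η) * (1# - t) - (1# - step t) ∎)
    where 0≤t = ≤-trans 0≤η η≤t

  ½*≤1 : ∀ {x} → x ≤ 1# → ½ * x ≤ 1#
  ½*≤1 x≤1 = halve (≤-trans x≤1 (≤-trans (≤-reflexive (sym (+-identityʳ 1#))) (+-monoʳ-≤ 1# 0≤1)))

  module _ {δ t} (0≤δ : 0# ≤ δ) (δ≤1 : δ ≤ 1#) (δ≤t : δ ≤ t) (t≤2 : t ≤ 1# + 1#) where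
    private
      η = ½ * δ
      0≤η = *-nonneg 0≤½ 0≤δ

      -t≤2 : - t ≤ 1# + 1#
      -t≤2 = from-nonneg (+-nonneg 0≤2 (≤-trans 0≤δ δ≤t))
        (solve 1 (λ t → con (+ 2) :+ t := con (+ 2) :- (:- t)) refl t)

      lower : ∀ k → η ≤ amplify k t
      lower zero    = *-monoˡ-≤ 0≤½ δ≤t
      lower (suc k) = step-increases 0≤η (lower k) (amplify≤1 k t≤2 -t≤2)

    amplify-error : ∀ k → 1# - amplify k t ≤ (1# - ½ * η) ^ k
    amplify-error zero    = from-nonneg (≤-trans 0≤η (lower 0))
      (solve 1 (λ x → x := con (+ 1) :- (con (+ 1) :- x)) refl _)
    amplify-error (suc k) = begin
      1# - amplify (suc k) t                ≤⟨ step-contracts 0≤η (lower k) (amplify≤1 k t≤2 -t≤2) ⟩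
      (1# - ½ * η) * (1# - amplify k t)     ≤⟨ *-monoˡ-≤ (to-nonneg (½*≤1 (½*≤1 δ≤1))) (amplify-error k) ⟩
      (1# - ½ * η) ^ suc k                  ∎

  amplifyᵖ : ∀ {N} → ℕ → Polynomial N → Polynomial N
  amplifyᵖ zero    p = scale ½ p
  amplifyᵖ (suc k) p = let q = amplifyᵖ k p in
    scale (½ * (1# + 1# + 1#)) q ++ scale (- ½) (q · (q · q))

  eval-amplify : ∀ {N} k (p : Polynomial N) x → eval (amplifyᵖ k p) x ≈ amplify k (eval p x)
  eval-amplify zero    p x = eval-scale ½ p x
  eval-amplify (suc k) p x = begin-equality
    eval (scale (½ * (1# + 1# + 1#)) q ++ scale (- ½) (q · (q · q))) x
      ≈⟨ eval-++ (scale (½ * (1# + 1# + 1#)) q) _ x ⟩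
    eval (scale (½ * (1# + 1# + 1#)) q) x + eval (scale (- ½) (q · (q · q))) x
      ≈⟨ +-cong (eval-scale _ q x) (eval-scale _ (q · (q · q)) x) ⟩
    ½ * (1# + 1# + 1#) * eval q x + - ½ * eval (q · (q · q)) x
      ≈⟨ +-congˡ (*-congˡ (trans (eval-· q (q · q) x) (*-congˡ (eval-· q q x)))) ⟩
    step (eval q x)
      ≈⟨ step-cong (eval-amplify k p x) ⟩
    amplify (suc k) (eval p x) ∎
    where q = amplifyᵖ k p

  degree-amplify : ∀ {N e} k {p : Polynomial N} → DegreeAtMost e p →
                   DegreeAtMost (3 ℕ.^ k ℕ.* e) (amplifyᵖ k p)
  degree-amplify {e = e} zero    p≤e = degree-mono (ℕ.≤-reflexive (≡.sym (ℕ.*-identityˡ e))) (degree-scale p≤e)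
  degree-amplify {e = e} (suc k) {p} p≤e = degree-mono
    (ℕ.≤-reflexive (≡.trans (≡.cong (λ n → d ℕ.+ (d ℕ.+ n)) (≡.sym (ℕ.+-identityʳ d)))
                            (≡.sym (ℕ.*-assoc 3 (3 ℕ.^ k) e))))
    (AllP.++⁺ (degree-mono (ℕ.m≤m+n d (d ℕ.+ d)) (degree-scale q≤d))
             (degree-scale (degree-· q≤d (degree-· q≤d q≤d))))
    where
    d = 3 ℕ.^ k ℕ.* e
    q≤d = degree-amplify k p≤e

  0≤⅓ : 0# ≤ ⅓
  0≤⅓ = proj₁ (⁻¹-pos (fromℕ-pos 2))

  module _ {δ} (0≤δ : 0# ≤ δ) (δ≤1 : δ ≤ 1#) (k : ℕ) (small : (1# - ½ * (½ * δ)) ^ k ≤ ⅓) where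
    private
      close⁺ : ∀ t → abs (1# - t) ≤ 1# - δ → abs (1# - amplify k t) ≤ ⅓
      close⁺ t 1-t≤ = abs-least
        (≤-trans (amplify-error 0≤δ δ≤1 δ≤t t≤2 k) small)
        (begin
          - (1# - amplify k t)   ≤⟨ neg-mono (to-nonneg (amplify≤1 k t≤2 -t≤2)) ⟩
          - 0#                   ≈⟨ solve 0 (:- con (+ 0) := con (+ 0)) refl ⟩
          0#                     ≤⟨ 0≤⅓ ⟩
          ⅓                      ∎)
        where
        δ≤t : δ ≤ t
        δ≤t = from-nonneg (to-nonneg (≤-trans (x≤abs _) 1-t≤))
          (solve 2 (λ δ t → (con (+ 1) :- δ) :- (con (+ 1) :- t) := t :- δ) refl δ t)
        t≤2 : t ≤ 1# + 1#
        t≤2 = from-nonneg (+-nonneg 0≤δ (to-nonneg (≤-trans (-x≤abs _) 1-t≤)))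
          (solve 2 (λ δ t → δ :+ ((con (+ 1) :- δ) :- (:- (con (+ 1) :- t))) := con (+ 2) :- t) refl δ t)
        -t≤2 : - t ≤ 1# + 1#
        -t≤2 = from-nonneg (+-nonneg 0≤2 (≤-trans 0≤δ δ≤t))
          (solve 1 (λ t → con (+ 2) :+ t := con (+ 2) :- (:- t)) refl t)

      close± : ∀ σ t → abs (⟦ σ ⟧ - t) ≤ 1# - δ → abs (⟦ σ ⟧ - amplify k t) ≤ ⅓
      close± Sign.+ t 1-t≤  = close⁺ t 1-t≤
      close± Sign.- t -1-t≤ = begin
        abs (- 1# - amplify k t)         ≈⟨ abs-cong (trans
            (solve 1 (λ a → (:- con (+ 1)) :- a := :- (con (+ 1) :- (:- a))) refl (amplify k t))
            (-‿cong (+-congˡ (-‿cong (sym (amplify-odd k t)))))) ⟩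
        abs (- (1# - amplify k (- t)))   ≤⟨ abs-neg _ ⟩
        abs (1# - amplify k (- t))       ≤⟨ close⁺ (- t) (begin
            abs (1# - - t)                 ≈⟨ abs-cong (solve 1 (λ t → con (+ 1) :- (:- t) := :- ((:- con (+ 1)) :- t)) refl t) ⟩
            abs (- (- 1# - t))             ≤⟨ abs-neg _ ⟩
            abs (- 1# - t)                 ≤⟨ -1-t≤ ⟩
            1# - δ                         ∎) ⟩
        ⅓                                ∎

      ≤2 : ∀ {v} → v ≤ 1# + (1# - δ) → v ≤ 1# + 1#
      ≤2 v≤ = ≤-trans v≤ (from-nonneg 0≤δ
        (solve 1 (λ δ → δ := con (+ 2) :- (con (+ 1) :+ (con (+ 1) :- δ))) refl δ))

      bounded± : ∀ v → abs v ≤ 1# + (1# - δ) → abs (amplify k v) ≤ 1# + ⅓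
      bounded± v v≤ = begin
        abs (amplify k v)   ≤⟨ abs-least (amplify≤1 k t≤2 -t≤2) (-amplify≤1 k t≤2 -t≤2) ⟩
        1#                  ≈⟨ +-identityʳ 1# ⟨
        1# + 0#             ≤⟨ +-monoʳ-≤ 1# 0≤⅓ ⟩
        1# + ⅓              ∎
        where
        t≤2 = ≤2 (≤-trans (x≤abs v) v≤)
        -t≤2 = ≤2 (≤-trans (-x≤abs v) v≤)

    amplifyᵖ-approximates : ∀ {N} {X : Point N → Set} {g : BooleanFunction X} p →
      Approximates (1# - δ) g p → Approximates ⅓ g (amplifyᵖ k p)
    amplifyᵖ-approximates {g = g} p approx = record
      { close = λ x x∈ → ≤-trans (≤-reflexive (abs-cong (+-congˡ (-‿cong (eval-amplify k p x)))))
                                 (close± (value x x∈) (eval p x) (close x x∈))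
      ; bounded = λ x x∈X x∉ → ≤-trans (≤-reflexive (abs-cong (eval-amplify k p x)))
                                       (bounded± (eval p x) (bounded x x∈X x∉))
      }
      where
      open BooleanFunction g
      open Approximates approx

  -- The number k of iterations makes (1 - δ/4)ᵏ ≤ 1/3, and each of them triples the degree, so K =
  -- 3ᵏ. It is chosen before g, so that one constant serves all factors in all dimensions.
  error-reduction : ∀ {δ} → 0# < δ → δ ≤ 1# → ∃ λ K → 1 ℕ.≤ K ×
    (∀ {N} {X : Point N → Set} {e} {g : BooleanFunction X} {p} →
     DegreeAtMost e p → Approximates (1# - δ) g p →
     ∃ λ q → DegreeAtMost (K ℕ.* e) q × Approximates ⅓ g q)
  error-reduction 0<δ δ≤1 =
    let k , small = small-power em (*-pos 0<½ (*-pos 0<½ 0<δ)) (½*≤1 (½*≤1 δ≤1))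
    in 3 ℕ.^ k , ℕ.m^n>0 3 k , λ {_} {_} {_} {_} {p} p≤e approx →
         amplifyᵖ k p , degree-amplify k p≤e , amplifyᵖ-approximates (proj₁ 0<δ) δ≤1 k small p approx

-- Integration against finitely supported signed measures.

module Integration (R : RealNumbers) where
  open OrderedField R
  open SemiringSum semiring using (*-distribˡ-sum; *-distribʳ-sum)

  -- Opaque, so that nested integrals are compared by their arguments and not unfolded into sums.
  opaque
    ∫ : ∀ {n} {A : Set} → Vector ℝ n → Vector A n → (A → ℝ) → ℝ
    ∫ w x f = ∑.sum (λ j → w j * f (x j))

    ∫-unfold : ∀ {n} {A : Set} (w : Vector ℝ n) (x : Vector A n) f → ∫ w x f ≈ ∑.sum (λ j → w j * f (x j))
    ∫-unfold w x f = refl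

  module _ {n} {A : Set} (w : Vector ℝ n) (x : Vector A n) where
    opaque
      unfolding ∫

      ∫-cong : ∀ {f g} → (∀ y → f y ≈ g y) → ∫ w x f ≈ ∫ w x g
      ∫-cong f≈g = ∑.sum-cong-≋ (λ j → *-congˡ (f≈g (x j)))

      ∫-linear : ∀ c f g → ∫ w x (λ y → c * f y + g y) ≈ c * ∫ w x f + ∫ w x g
      ∫-linear c f g = begin-equality
        ∑.sum (λ j → w j * (c * f (x j) + g (x j)))
          ≈⟨ ∑.sum-cong-≋ (λ j → solve 4 (λ w c f g → w :* (c :* f :+ g) := c :* (w :* f) :+ w :* g) refl
               (w j) c (f (x j)) (g (x j))) ⟩
        ∑.sum (λ j → c * (w j * f (x j)) + w j * g (x j))
          ≈⟨ ∑.∑-distrib-+ (λ j → c * (w j * f (x j))) _ ⟩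
        ∑.sum (λ j → c * (w j * f (x j))) + ∫ w x g
          ≈⟨ +-congʳ (sym (*-distribˡ-sum c (λ j → w j * f (x j)))) ⟩
        c * ∫ w x f + ∫ w x g ∎

      ∫-*ʳ : ∀ f c → ∫ w x (λ y → f y * c) ≈ ∫ w x f * c
      ∫-*ʳ f c = begin-equality
        ∑.sum (λ j → w j * (f (x j) * c))   ≈⟨ ∑.sum-cong-≋ (λ j → sym (*-assoc (w j) (f (x j)) c)) ⟩
        ∑.sum (λ j → w j * f (x j) * c)     ≈⟨ *-distribʳ-sum c (λ j → w j * f (x j)) ⟨
        ∫ w x f * c                         ∎

      ∫-bound : ∀ {f a b} → ∑.sum (λ j → abs (w j)) ≤ a → 0# ≤ b → (∀ j → abs (f (x j)) ≤ b) →
                abs (∫ w x f) ≤ a * b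
      ∫-bound {f} {a} {b} Σ|w|≤a 0≤b f≤b = begin
        abs (∫ w x f)                        ≤⟨ abs-∑ (λ j → w j * f (x j)) ⟩
        ∑.sum (λ j → abs (w j * f (x j)))    ≤⟨ ∑-mono (λ j → ≤-trans (abs-* (w j) (f (x j)))
                                                                      (*-monoˡ-≤ (abs-nonneg (w j)) (f≤b j))) ⟩
        ∑.sum (λ j → abs (w j) * b)          ≈⟨ *-distribʳ-sum b (λ j → abs (w j)) ⟨
        ∑.sum (λ j → abs (w j)) * b          ≤⟨ *-monoʳ-≤ 0≤b Σ|w|≤a ⟩
        a * b                                ∎

-- Dual measures witnessing that a function has no low-degree approximation.

module DualMeasures (em : ExcludedMiddle 0ℓ) (R : RealNumbers) where
  open Lists using ([]; _∷_; _++_)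
  open Alls using ([]; _∷_)
  open OrderedField R
  open SemiringSum semiring using (*-distribˡ-sum)
  open Polynomials R
  open Duality em R
  open Integration R public

  -- A finitely supported signed measure, split into a part which agrees with
  -- a Boolean function and a part consisting of errors.
  record Measure (m : ℕ) : Set where
    field
      {size}        : ℕ
      point         : Vector (Point m) size
      correct error : Vector ℝ size

  -- `weight` is the absolute value of `correct`, kept as data so that it can be summed directly.
  -- The first alternative of `correct-sign` covers points outside the domain, where there is no
  -- sign to agree with.
  record IsDual {m} {X : Point m → Set} (g : BooleanFunction X) (δ : ℝ)
                (Low : Vector ℕ m → Set) (μ : Measure m) : Set where
    open BooleanFunction g
    open Measure μ
    field
      point∈        : ∀ j → X (point j)
      weight        : Vector ℝ size
      weight-nonneg : ∀ j → 0# ≤ weight j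
      weight-total  : ∑.sum weight ≈ 1#
      correct-sign  : ∀ j → (weight j ≈ 0# × correct j ≈ 0#) ⊎
                            (∃ λ x∈ → correct j ≈ weight j * ⟦ value (point j) x∈ ⟧)
      error-small   : ∑.sum (λ j → abs (error j)) ≤ δ
      orthogonal    : ∀ α → Low α →
                      ∫ correct point (monomial α) + ∫ error point (monomial α) ≈ 0#

  abs-⟦⟧ : ∀ σ → abs ⟦ σ ⟧ ≤ 1#
  abs-⟦⟧ Sign.+ = ≤-reflexive (abs-of-nonneg 0≤1)
  abs-⟦⟧ Sign.- = ≤-trans (abs-neg 1#) (≤-reflexive (abs-of-nonneg 0≤1))

  abs-*⟦⟧ : ∀ x σ → abs (x * ⟦ σ ⟧) ≤ abs x
  abs-*⟦⟧ x σ = begin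
    abs (x * ⟦ σ ⟧)      ≤⟨ abs-* x ⟦ σ ⟧ ⟩
    abs x * abs ⟦ σ ⟧    ≤⟨ *-monoˡ-≤ (abs-nonneg x) (abs-⟦⟧ σ) ⟩
    abs x * 1#           ≈⟨ *-identityʳ (abs x) ⟩
    abs x                ∎

  ⟦⟧-square : ∀ σ → ⟦ σ ⟧ * ⟦ σ ⟧ ≈ 1#
  ⟦⟧-square Sign.+ = *-identityˡ 1#
  ⟦⟧-square Sign.- = solve 0 ((:- con (+ 1)) :* (:- con (+ 1)) := con (+ 1)) refl

  module _ {m} {X : Point m → Set} (X-finite : IsFiniteSet X) (g : BooleanFunction X)
           {δ} (δ<1 : δ < 1#) (0≤δ : 0# ≤ δ) (Low : Vector ℕ m → Set)
           (infeasible : ∀ p → All (λ (_ , α) → Low α) p → ¬ Approximates (1# - δ) g p) where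
    open BooleanFunction g
    open IsFiniteSet X-finite

    private
      -- The list of a finite set only has to cover it and may contain other points. These are
      -- filtered out, since nothing is known about an approximant outside X.
      members : List (Point m) → List (∃ X)
      members []       = []
      members (x ∷ xs) with em {X x}
      ... | yes x∈ = (x , x∈) ∷ members xs
      ... | no  _  = members xs

      ∈-members : ∀ xs {x} → X x → Any (x ≋_) xs → Any (λ y → x ≋ proj₁ y) (members xs)
      ∈-members (y ∷ xs) x∈ x∈xs with em {X y} | x∈xs
      ... | yes _  | here x≋y = here x≋y
      ... | yes _  | there i  = there (∈-members xs x∈ i)
      ... | no y∉  | here x≋y = ⊥-elim (y∉ (respects x≋y x∈))
      ... | no _   | there i  = ∈-members xs x∈ i

      n = Lists.length (members elements)

      point : Vector (Point m) n
      point j = proj₁ (Lists.lookup (members elements) j)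

      point∈ : ∀ j → X (point j)
      point∈ j = proj₂ (Lists.lookup (members elements) j)

      covered : ∀ x → X x → ∃ λ j → x ≋ point j
      covered x x∈ = Any.index i , AnyP.lookup-index i
        where i = ∈-members elements x∈ (exhaustive x x∈)

      -- The two clauses of approximation form one box: an interval of radius 1 - δ around the value
      -- on the domain, and of radius 2 - δ around 0 elsewhere.
      centre-of radius-of : ∀ {x} → Dec (dom x) → ℝ
      centre-of (yes x∈) = ⟦ value _ x∈ ⟧
      centre-of (no _)   = 0#
      radius-of (yes _)  = 1# - δ
      radius-of (no _)   = 1# + (1# - δ)

      centre radius : Vector ℝ n
      centre j = centre-of (em {dom (point j)})
      radius j = radius-of (em {dom (point j)})

      0<1-δ : 0# < 1# - δ
      0<1-δ = to-nonneg (proj₁ δ<1) , λ 0≈ → proj₂ δ<1 (begin-equality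
        δ              ≈⟨ +-identityˡ δ ⟨
        0# + δ         ≈⟨ +-congʳ 0≈ ⟩
        1# - δ + δ     ≈⟨ solve 1 (λ δ → con (+ 1) :- δ :+ δ := con (+ 1)) refl δ ⟩
        1#             ∎)

      radius-pos : ∀ {x} (x∈? : Dec (dom x)) → 0# < radius-of x∈?
      radius-pos (yes _) = 0<1-δ
      radius-pos (no _)  = +-pos-nonneg 0<1 (proj₁ 0<1-δ)

      W : Vector ℝ n → Set
      W w = ∃ λ p → All (λ (_ , α) → Low α) p × ∀ j → eval p (point j) ≈ w j

      W-subspace : IsSubspace W
      W-subspace = record
        { respects = λ v≈w (p , low , p≈) → p , low , λ j → trans (p≈ j) (v≈w j)
        ; zero∈    = [] , [] , λ _ → refl
        ; add      = λ (p , p-low , p≈) (q , q-low , q≈) → p ++ q , AllP.++⁺ p-low q-low ,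
                       λ j → trans (eval-++ p q (point j)) (+-cong (p≈ j) (q≈ j))
        ; scale    = λ c (p , low , p≈) → scale c p , AllP.map⁺ low ,
                       λ j → trans (eval-scale c p (point j)) (*-congˡ (p≈ j))
        }

      box-misses-W : ¬ (∃ λ w → W w × ∀ j → abs (centre j - w j) ≤ radius j)
      box-misses-W (w , (p , low , p≈) , in-box) = infeasible p low record
        { close   = λ x x∈ → let j , x≋ = covered x (dom⊆X x∈) in
            close-at x∈ x≋ (em {dom (point j)}) (value-near j x≋) (in-box j)
        ; bounded = λ x x∈X x∉ → let j , x≋ = covered x x∈X in
            bounded-at x∉ x≋ (em {dom (point j)}) (value-near j x≋) (in-box j)
        }
        where
        value-near : ∀ {x} j → x ≋ point j → eval p x ≈ w j
        value-near j x≋ = trans (eval-cong p x≋) (p≈ j)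

        close-at : ∀ {x y v} (x∈ : dom x) → x ≋ y → (y∈? : Dec (dom y)) → eval p x ≈ v →
                   abs (centre-of y∈? - v) ≤ radius-of y∈? → abs (⟦ value x x∈ ⟧ - eval p x) ≤ 1# - δ
        close-at x∈ x≋y (no y∉)  _  _  = ⊥-elim (y∉ (dom-respects x≋y x∈))
        close-at {x} {y} x∈ x≋y (yes y∈) p≈ ≤r = ≤-trans
          (≤-reflexive (abs-cong (+-cong (reflexive (≡.cong ⟦_⟧ (value-cong x∈ y∈ x≋y))) (-‿cong p≈)))) ≤r

        bounded-at : ∀ {x y v} → ¬ dom x → x ≋ y → (y∈? : Dec (dom y)) → eval p x ≈ v →
                     abs (centre-of y∈? - v) ≤ radius-of y∈? → abs (eval p x) ≤ 1# + (1# - δ)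
        bounded-at x∉ x≋y (yes y∈) _ _ = ⊥-elim (x∉ (dom-respects (λ j → sym (x≋y j)) y∈))
        bounded-at {x} {v = v} x∉ x≋y (no _) p≈ ≤r = begin
          abs (eval p x)    ≈⟨ abs-cong (trans p≈ (solve 1 (λ v → v := :- (con (+ 0) :- v)) refl v)) ⟩
          abs (- (0# - v))  ≤⟨ abs-neg _ ⟩
          abs (0# - v)      ≤⟨ ≤r ⟩
          1# + (1# - δ)     ∎

      dual = box-duality W-subspace centre radius (λ j → radius-pos (em {dom (point j)})) box-misses-W
      a = proj₁ dual

      -- Summed over the points, `gain` makes the total weight A at least the correlation, hence at
      -- least 1. Summed, `cost` bounds total error minus δ A by norm minus correlation, which is at
      -- most 1 - 1, so the total error is at most δ A.
      record Split (x : Point m) (a centre radius : ℝ) : Set where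
        field
          correct error weight : ℝ
          decomposition : correct + error ≈ a
          nonneg        : 0# ≤ weight
          sign          : (weight ≈ 0# × correct ≈ 0#) ⊎ ∃ λ x∈ → correct ≈ weight * ⟦ value x x∈ ⟧
          cost          : abs error - δ * weight ≤ abs a * radius - a * centre
          gain          : a * centre ≤ weight

      -- The whole mass at a point is correct if its sign agrees with the value there, and error
      -- otherwise. Agreement makes `cost` an equality up to a ≤ |a|; disagreement costs at most |a|
      -- because the right side is then |a| (2 - δ).
      split : ∀ {x} (a : ℝ) (x∈? : Dec (dom x)) → Split x a (centre-of x∈?) (radius-of x∈?)
      split a (no _) = record
        { correct = 0# ; error = a ; weight = 0#
        ; decomposition = +-identityˡ a ; nonneg = ≤-refl ; sign = inj₁ (refl , refl)
        ; cost = from-nonneg (*-nonneg (abs-nonneg a) (proj₁ 0<1-δ))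
            (solve 3 (λ b a δ → b :* (con (+ 1) :- δ) :=
               (b :* (con (+ 1) :+ (con (+ 1) :- δ)) :- a :* con (+ 0)) :- (b :- δ :* con (+ 0)))
              refl (abs a) a δ)
        ; gain = ≤-reflexive (zeroʳ a) }
      split a (yes x∈) with total 0# (a * ⟦ value _ x∈ ⟧)
      ... | inj₁ 0≤aσ = record
        { correct = a ; error = 0# ; weight = a * σ
        ; decomposition = +-identityʳ a ; nonneg = 0≤aσ
        ; sign = inj₂ (x∈ , sym (begin-equality
            a * σ * σ    ≈⟨ *-assoc a σ σ ⟩
            a * (σ * σ)  ≈⟨ *-congˡ (⟦⟧-square (value _ x∈)) ⟩
            a * 1#       ≈⟨ *-identityʳ a ⟩
            a            ∎))
        ; cost = from-nonneg (*-nonneg (to-nonneg aσ≤|a|) (proj₁ 0<1-δ)) (begin-equality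
            (abs a - a * σ) * (1# - δ)
              ≈⟨ solve 3 (λ b c δ → (b :- c) :* (con (+ 1) :- δ) :=
                   (b :* (con (+ 1) :- δ) :- c) :- (con (+ 0) :- δ :* c)) refl (abs a) (a * σ) δ ⟩
            abs a * (1# - δ) - a * σ - (0# - δ * (a * σ))
              ≈⟨ +-congˡ (-‿cong (+-congʳ (abs-of-nonneg ≤-refl))) ⟨
            abs a * (1# - δ) - a * σ - (abs 0# - δ * (a * σ)) ∎)
        ; gain = ≤-refl }
        where
        σ = ⟦ value _ x∈ ⟧
        aσ≤|a| : a * σ ≤ abs a
        aσ≤|a| = ≤-trans (x≤abs _) (abs-*⟦⟧ a (value _ x∈))
      ... | inj₂ aσ≤0 = record
        { correct = 0# ; error = a ; weight = 0#
        ; decomposition = +-identityˡ a ; nonneg = ≤-refl ; sign = inj₁ (refl , refl)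
        ; cost = from-nonneg
            (+-nonneg (to-nonneg |a|≤-aσ) (*-nonneg (abs-nonneg a) (proj₁ 0<1-δ)))
            (solve 3 (λ b c δ → ((:- c) :- b) :+ b :* (con (+ 1) :- δ) :=
               (b :* (con (+ 1) :- δ) :- c) :- (b :- δ :* con (+ 0))) refl (abs a) (a * σ) δ)
        ; gain = aσ≤0 }
        where
        σ = ⟦ value _ x∈ ⟧
        |a|≤-aσ : abs a ≤ - (a * σ)
        |a|≤-aσ = begin
          abs a              ≈⟨ abs-cong (begin-equality
            a * σ * σ          ≈⟨ *-assoc a σ σ ⟩
            a * (σ * σ)        ≈⟨ *-congˡ (⟦⟧-square (value _ x∈)) ⟩
            a * 1#             ≈⟨ *-identityʳ a ⟩
            a                  ∎) ⟨
          abs (a * σ * σ)    ≤⟨ abs-*⟦⟧ (a * σ) (value _ x∈) ⟩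
          abs (a * σ)        ≤⟨ abs-least (≤-trans aσ≤0 0≤-aσ) ≤-refl ⟩
          - (a * σ)          ∎
          where 0≤-aσ = nonpos⇒neg-nonneg aσ≤0

      module S j = Split (split {point j} (a j) (em {dom (point j)}))

      A = ∑.sum S.weight

      1≤A : 1# ≤ A
      1≤A = ≤-trans (proj₂ (proj₂ (proj₂ dual))) (∑-mono S.gain)

      0<A : 0# < A
      0<A = <-≤-trans 0<1 1≤A

      0≤A⁻¹ = proj₁ (⁻¹-pos 0<A)

      ∑-difference : ∀ {n} c (f h : Vector ℝ n) → ∑.sum (λ j → f j - c * h j) ≈ ∑.sum f - c * ∑.sum h
      ∑-difference c f h = begin-equality
        ∑.sum (λ j → f j - c * h j)             ≈⟨ ∑.sum-cong-≋ (λ j → solve 3 (λ f c h → f :- c :* h := f :+ (:- c) :* h) refl (f j) c (h j)) ⟩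
        ∑.sum (λ j → f j + - c * h j)           ≈⟨ ∑.∑-distrib-+ f (λ j → - c * h j) ⟩
        ∑.sum f + ∑.sum (λ j → - c * h j)       ≈⟨ +-congˡ (*-distribˡ-sum (- c) h) ⟨
        ∑.sum f + - c * ∑.sum h                 ≈⟨ solve 3 (λ f c h → f :+ (:- c) :* h := f :- c :* h) refl (∑.sum f) c (∑.sum h) ⟩
        ∑.sum f - c * ∑.sum h                   ∎

      total-error : ∑.sum (λ j → abs (S.error j)) ≤ A * δ
      total-error = from-nonneg
        (+-nonneg (to-nonneg (∑-mono S.cost)) (+-nonneg
          (to-nonneg (proj₁ (proj₂ (proj₂ dual)))) (to-nonneg (proj₂ (proj₂ (proj₂ dual))))))
        (begin-equality
          (∑.sum (λ j → abs (a j) * radius j - a j * centre j) - ∑.sum (λ j → abs (S.error j) - δ * S.weight j))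
            + ((1# - ∑.sum (λ j → abs (a j) * radius j)) + (∑.sum (λ j → a j * centre j) - 1#))
            ≈⟨ +-congʳ (+-cong
                 (trans (∑.sum-cong-≋ (λ j → +-congˡ (-‿cong (sym (*-identityˡ (a j * centre j))))))
                        (∑-difference 1# (λ j → abs (a j) * radius j) (λ j → a j * centre j)))
                 (-‿cong (∑-difference δ (λ j → abs (S.error j)) S.weight))) ⟩
          (N - 1# * T - (E - δ * A)) + ((1# - N) + (T - 1#))
            ≈⟨ solve 5 (λ N T E δ A → (N :- con (+ 1) :* T :- (E :- δ :* A)) :+ ((con (+ 1) :- N) :+ (T :- con (+ 1))) :=
                 A :* δ :- E) refl N T E δ A ⟩
          A * δ - E ∎)
        where
        N = ∑.sum (λ j → abs (a j) * radius j)
        T = ∑.sum (λ j → a j * centre j)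
        E = ∑.sum (λ j → abs (S.error j))

      normalised-sign : ∀ {x w c} → (w ≈ 0# × c ≈ 0#) ⊎ (∃ λ x∈ → c ≈ w * ⟦ value x x∈ ⟧) →
        (A ⁻¹ * w ≈ 0# × A ⁻¹ * c ≈ 0#) ⊎ (∃ λ x∈ → A ⁻¹ * c ≈ A ⁻¹ * w * ⟦ value x x∈ ⟧)
      normalised-sign (inj₁ (w≈0 , c≈0)) = inj₁ (trans (*-congˡ w≈0) (zeroʳ _) , trans (*-congˡ c≈0) (zeroʳ _))
      normalised-sign (inj₂ (x∈ , c≈))   = inj₂ (x∈ , trans (*-congˡ c≈) (sym (*-assoc _ _ _)))

    -- The dual vector of the box is split pointwise and divided by the total correct weight A.
    -- Orthogonality to a monomial is orthogonality to the one-term polynomial in `W`.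
    dual-measure : ∃ (IsDual g δ Low)
    dual-measure = record { point = point ; correct = λ j → A ⁻¹ * S.correct j ; error = λ j → A ⁻¹ * S.error j } , record
      { point∈ = point∈
      ; weight = λ j → A ⁻¹ * S.weight j
      ; weight-nonneg = λ j → *-nonneg 0≤A⁻¹ (S.nonneg j)
      ; weight-total = begin-equality
          ∑.sum (λ j → A ⁻¹ * S.weight j)    ≈⟨ *-distribˡ-sum (A ⁻¹) S.weight ⟨
          A ⁻¹ * A                           ≈⟨ *-comm _ _ ⟩
          A * A ⁻¹                           ≈⟨ inverseʳ 0<A ⟩
          1#                                 ∎
      ; correct-sign = λ j → normalised-sign (S.sign j)
      ; error-small = begin
          ∑.sum (λ j → abs (A ⁻¹ * S.error j))     ≤⟨ ∑-mono (λ j → abs-* (A ⁻¹) (S.error j)) ⟩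
          ∑.sum (λ j → abs (A ⁻¹) * abs (S.error j)) ≈⟨ *-distribˡ-sum (abs (A ⁻¹)) (λ j → abs (S.error j)) ⟨
          abs (A ⁻¹) * ∑.sum (λ j → abs (S.error j)) ≈⟨ *-congʳ (abs-of-nonneg 0≤A⁻¹) ⟩
          A ⁻¹ * ∑.sum (λ j → abs (S.error j))     ≤⟨ *-monoˡ-≤ 0≤A⁻¹ total-error ⟩
          A ⁻¹ * (A * δ)                           ≈⟨ cancel-inverse δ 0<A ⟩
          δ                                        ∎
      ; orthogonal = λ α low → begin-equality
          ∫ (λ j → A ⁻¹ * S.correct j) point (monomial α) + ∫ (λ j → A ⁻¹ * S.error j) point (monomial α)
            ≈⟨ +-cong (∫-unfold _ point (monomial α)) (∫-unfold _ point (monomial α)) ⟩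
          ∑.sum (λ j → A ⁻¹ * S.correct j * M α j) + ∑.sum (λ j → A ⁻¹ * S.error j * M α j)
            ≈⟨ ∑.∑-distrib-+ (λ j → A ⁻¹ * S.correct j * M α j) (λ j → A ⁻¹ * S.error j * M α j) ⟨
          ∑.sum (λ j → A ⁻¹ * S.correct j * M α j + A ⁻¹ * S.error j * M α j)
            ≈⟨ ∑.sum-cong-≋ (λ j → trans
                 (solve 4 (λ i c e x → i :* c :* x :+ i :* e :* x := i :* ((c :+ e) :* x)) refl
                   (A ⁻¹) (S.correct j) (S.error j) (M α j))
                 (*-congˡ (*-congʳ (S.decomposition j)))) ⟩
          ∑.sum (λ j → A ⁻¹ * (a j * M α j))
            ≈⟨ *-distribˡ-sum (A ⁻¹) (λ j → a j * M α j) ⟨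
          A ⁻¹ * ∑.sum (λ j → a j * M α j)
            ≈⟨ *-congˡ (proj₁ (proj₂ dual) (M α) ((1# , α) ∷ [] , low ∷ [] , λ j →
                 solve 1 (λ x → con (+ 1) :* x :+ con (+ 0) := x) refl (M α j))) ⟩
          A ⁻¹ * 0#
            ≈⟨ zeroʳ _ ⟩
          0# ∎
      }
      where
      M : Vector ℕ m → Vector ℝ n
      M α j = monomial α (point j)

-- The product of dual measures with points of few errors removed.

module ProductMeasure (em : ExcludedMiddle 0ℓ) (R : RealNumbers) where
  open Vector using ([]; _∷_)
  open OrderedField R
  open SemiringSum semiring using (*-distribˡ-sum; *-distribʳ-sum)
  open Polynomials R
  open DualMeasures em R

  ∫ᶜ ∫ᵉ ∫ᵗ : ∀ {m} → Measure m → (Point m → ℝ) → ℝ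
  ∫ᶜ μ = ∫ (Measure.correct μ) (Measure.point μ)
  ∫ᵉ μ = ∫ (Measure.error μ) (Measure.point μ)
  ∫ᵗ μ f = ∫ᶜ μ f + ∫ᵉ μ f

  slice : ∀ {n m} → ((Fin (suc n) → Point m) → ℝ) → Point m → (Fin n → Point m) → ℝ
  slice F x y = F (x ∷ y)

  -- Let z be the number of error coordinates of a point of the support of the
  -- product measure.  `layer k` integrates against the product measure with
  -- density (-1)ᵏ C(z,k), and `truncated k` with density
  -- Σ_{j≤k} (-1)ʲ C(z,j), which is 1 for z = 0 and 0 for 1 ≤ z ≤ k.
  layer : ∀ {n m} → (Fin n → Measure m) → ℕ → ((Fin n → Point m) → ℝ) → ℝ
  layer {zero}  μ zero    F = F []
  layer {zero}  μ (suc k) F = 0#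
  layer {suc n} μ zero    F = ∫ᵗ (μ zero) (λ x → layer (tail μ) zero (slice F x))
  layer {suc n} μ (suc k) F = ∫ᵗ (μ zero) (λ x → layer (tail μ) (suc k) (slice F x))
                            - ∫ᵉ (μ zero) (λ x → layer (tail μ) k (slice F x))

  truncated : ∀ {n m} → (Fin n → Measure m) → ℕ → ((Fin n → Point m) → ℝ) → ℝ
  truncated {zero}  μ k F = F []
  truncated {suc n} μ k F = ∫ᶜ (μ zero) (λ x → truncated (tail μ) k (slice F x))
                          + ∫ᵉ (μ zero) (λ x → layer (tail μ) k (slice F x))

  ∫ᶜ-cong : ∀ {m} (μ : Measure m) {f g} → (∀ x → f x ≈ g x) → ∫ᶜ μ f ≈ ∫ᶜ μ g
  ∫ᶜ-cong μ = ∫-cong (Measure.correct μ) (Measure.point μ)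

  ∫ᵉ-cong : ∀ {m} (μ : Measure m) {f g} → (∀ x → f x ≈ g x) → ∫ᵉ μ f ≈ ∫ᵉ μ g
  ∫ᵉ-cong μ = ∫-cong (Measure.error μ) (Measure.point μ)

  ∫ᵗ-cong : ∀ {m} (μ : Measure m) {f g} → (∀ x → f x ≈ g x) → ∫ᵗ μ f ≈ ∫ᵗ μ g
  ∫ᵗ-cong μ f≈g = +-cong (∫ᶜ-cong μ f≈g) (∫ᵉ-cong μ f≈g)

  ∫ᶜ-linear : ∀ {m} (μ : Measure m) c f g → ∫ᶜ μ (λ x → c * f x + g x) ≈ c * ∫ᶜ μ f + ∫ᶜ μ g
  ∫ᶜ-linear μ = ∫-linear (Measure.correct μ) (Measure.point μ)

  ∫ᵉ-linear : ∀ {m} (μ : Measure m) c f g → ∫ᵉ μ (λ x → c * f x + g x) ≈ c * ∫ᵉ μ f + ∫ᵉ μ g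
  ∫ᵉ-linear μ = ∫-linear (Measure.error μ) (Measure.point μ)

  ∫ᵗ-linear : ∀ {m} (μ : Measure m) c f g → ∫ᵗ μ (λ x → c * f x + g x) ≈ c * ∫ᵗ μ f + ∫ᵗ μ g
  ∫ᵗ-linear μ c f g = trans (+-cong (∫ᶜ-linear μ c f g) (∫ᵉ-linear μ c f g))
    (solve 5 (λ c x y z w → c :* x :+ y :+ (c :* z :+ w) := c :* (x :+ z) :+ (y :+ w)) refl c _ _ _ _)

  layer-cong : ∀ {n m} (μ : Fin n → Measure m) k {F G} → (∀ y → F y ≈ G y) → layer μ k F ≈ layer μ k G
  layer-cong {zero}  μ zero    F≈G = F≈G []
  layer-cong {zero}  μ (suc k) F≈G = refl
  layer-cong {suc n} μ zero    F≈G = ∫ᵗ-cong (μ zero) (λ x → layer-cong (tail μ) zero (λ y → F≈G (x ∷ y)))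
  layer-cong {suc n} μ (suc k) F≈G = +-cong
    (∫ᵗ-cong (μ zero) (λ x → layer-cong (tail μ) (suc k) (λ y → F≈G (x ∷ y))))
    (-‿cong (∫ᵉ-cong (μ zero) (λ x → layer-cong (tail μ) k (λ y → F≈G (x ∷ y)))))

  truncated-cong : ∀ {n m} (μ : Fin n → Measure m) k {F G} → (∀ y → F y ≈ G y) →
                   truncated μ k F ≈ truncated μ k G
  truncated-cong {zero}  μ k F≈G = F≈G []
  truncated-cong {suc n} μ k F≈G = +-cong
    (∫ᶜ-cong (μ zero) (λ x → truncated-cong (tail μ) k (λ y → F≈G (x ∷ y))))
    (∫ᵉ-cong (μ zero) (λ x → layer-cong (tail μ) k (λ y → F≈G (x ∷ y))))

  layer-linear : ∀ {n m} (μ : Fin n → Measure m) k c F G →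
                 layer μ k (λ y → c * F y + G y) ≈ c * layer μ k F + layer μ k G
  layer-linear {zero}  μ zero    c F G = refl
  layer-linear {zero}  μ (suc k) c F G = solve 1 (λ c → con (+ 0) := c :* con (+ 0) :+ con (+ 0)) refl c
  layer-linear {suc n} μ zero    c F G = trans
    (∫ᵗ-cong (μ zero) (λ x → layer-linear (tail μ) zero c (slice F x) (slice G x))) (∫ᵗ-linear (μ zero) c _ _)
  layer-linear {suc n} μ (suc k) c F G = trans
    (+-cong (trans (∫ᵗ-cong (μ zero) (λ x → layer-linear (tail μ) (suc k) c (slice F x) (slice G x))) (∫ᵗ-linear (μ zero) c _ _))
            (-‿cong (trans (∫ᵉ-cong (μ zero) (λ x → layer-linear (tail μ) k c (slice F x) (slice G x))) (∫ᵉ-linear (μ zero) c _ _))))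
    (solve 5 (λ c x y z w → c :* x :+ y :- (c :* z :+ w) := c :* (x :- z) :+ (y :- w)) refl c _ _ _ _)

  truncated-linear : ∀ {n m} (μ : Fin n → Measure m) k c F G →
                     truncated μ k (λ y → c * F y + G y) ≈ c * truncated μ k F + truncated μ k G
  truncated-linear {zero}  μ k c F G = refl
  truncated-linear {suc n} μ k c F G = trans
    (+-cong (trans (∫ᶜ-cong (μ zero) (λ x → truncated-linear (tail μ) k c (slice F x) (slice G x))) (∫ᶜ-linear (μ zero) c _ _))
            (trans (∫ᵉ-cong (μ zero) (λ x → layer-linear (tail μ) k c (slice F x) (slice G x))) (∫ᵉ-linear (μ zero) c _ _)))
    (solve 5 (λ c x y z w → c :* x :+ y :+ (c :* z :+ w) := c :* (x :+ z) :+ (y :+ w)) refl c _ _ _ _)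

  module _ {A : Set} (T : (A → ℝ) → ℝ)
           (cong : ∀ {F G} → (∀ y → F y ≈ G y) → T F ≈ T G)
           (linear : ∀ c F G → T (λ y → c * F y + G y) ≈ c * T F + T G) where

    linear⇒zero : T (λ _ → 0#) ≈ 0#
    linear⇒zero = begin-equality
      T (λ _ → 0#)                        ≈⟨ cong (λ _ → solve 0 (con (+ 0) := (:- con (+ 1)) :* con (+ 0) :+ con (+ 0)) refl) ⟩
      T (λ _ → - 1# * 0# + 0#)            ≈⟨ linear (- 1#) (λ _ → 0#) (λ _ → 0#) ⟩
      - 1# * T (λ _ → 0#) + T (λ _ → 0#)  ≈⟨ solve 1 (λ t → (:- con (+ 1)) :* t :+ t := con (+ 0)) refl _ ⟩
      0#                                  ∎

    linear⇒scale : ∀ c F → T (λ y → c * F y) ≈ c * T F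
    linear⇒scale c F = begin-equality
      T (λ y → c * F y)            ≈⟨ cong (λ y → sym (+-identityʳ _)) ⟩
      T (λ y → c * F y + 0#)       ≈⟨ linear c F (λ _ → 0#) ⟩
      c * T F + T (λ _ → 0#)       ≈⟨ +-congˡ linear⇒zero ⟩
      c * T F + 0#                 ≈⟨ +-identityʳ _ ⟩
      c * T F                      ∎

  layer-scale : ∀ {n m} (μ : Fin n → Measure m) k c F → layer μ k (λ y → c * F y) ≈ c * layer μ k F
  layer-scale μ k = linear⇒scale (layer μ k) (layer-cong μ k) (layer-linear μ k)

  truncated-scale : ∀ {n m} (μ : Fin n → Measure m) k c F →
                    truncated μ k (λ y → c * F y) ≈ c * truncated μ k F
  truncated-scale μ k = linear⇒scale (truncated μ k) (truncated-cong μ k) (truncated-linear μ k)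

  truncated-zero : ∀ {n m} (μ : Fin n → Measure m) k → truncated μ k (λ _ → 0#) ≈ 0#
  truncated-zero μ k = linear⇒zero (truncated μ k) (truncated-cong μ k) (truncated-linear μ k)

  -- The values of `layer` and `truncated` at a product of functions whose
  -- integrals over the correct parts are c and over the errors e.
  layerᵖ truncatedᵖ : ∀ {n} → Vector ℝ n → Vector ℝ n → ℕ → ℝ
  layerᵖ {zero}  c e zero    = 1#
  layerᵖ {zero}  c e (suc k) = 0#
  layerᵖ {suc n} c e zero    = (c zero + e zero) * layerᵖ (tail c) (tail e) zero
  layerᵖ {suc n} c e (suc k) = (c zero + e zero) * layerᵖ (tail c) (tail e) (suc k)
                             - e zero * layerᵖ (tail c) (tail e) k
  truncatedᵖ {zero}  c e k = 1#
  truncatedᵖ {suc n} c e k = c zero * truncatedᵖ (tail c) (tail e) k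
                           + e zero * layerᵖ (tail c) (tail e) k

  module _ {m} (μ : Measure m) (f : Point m → ℝ) where
    ∫ᶜ-factor : ∀ {G c} → (∀ x → G x ≈ f x * c) → ∫ᶜ μ G ≈ ∫ᶜ μ f * c
    ∫ᶜ-factor {c = c} G≈ = trans (∫ᶜ-cong μ G≈) (∫-*ʳ (Measure.correct μ) (Measure.point μ) f c)

    ∫ᵉ-factor : ∀ {G c} → (∀ x → G x ≈ f x * c) → ∫ᵉ μ G ≈ ∫ᵉ μ f * c
    ∫ᵉ-factor {c = c} G≈ = trans (∫ᵉ-cong μ G≈) (∫-*ʳ (Measure.error μ) (Measure.point μ) f c)

    ∫ᵗ-factor : ∀ {G c} → (∀ x → G x ≈ f x * c) → ∫ᵗ μ G ≈ ∫ᵗ μ f * c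
    ∫ᵗ-factor {c = c} G≈ = trans (+-cong (∫ᶜ-factor G≈) (∫ᵉ-factor G≈))
      (solve 3 (λ x y c → x :* c :+ y :* c := (x :+ y) :* c) refl _ _ c)

  layer-product : ∀ {n m} (μ : Fin n → Measure m) k (f : Fin n → Point m → ℝ) →
    layer μ k (λ y → ∏.sum (λ i → f i (y i))) ≈
    layerᵖ (λ i → ∫ᶜ (μ i) (f i)) (λ i → ∫ᵉ (μ i) (f i)) k
  layer-product {zero}  μ zero    f = refl
  layer-product {zero}  μ (suc k) f = refl
  layer-product {suc n} μ zero    f = ∫ᵗ-factor (μ zero) (f zero) λ x →
    trans (layer-scale (tail μ) zero (f zero x) (λ y → ∏.sum (λ i → tail f i (y i)))) (*-congˡ (layer-product (tail μ) zero (tail f)))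
  layer-product {suc n} μ (suc k) f = +-cong
    (∫ᵗ-factor (μ zero) (f zero) λ x →
      trans (layer-scale (tail μ) (suc k) (f zero x) (λ y → ∏.sum (λ i → tail f i (y i)))) (*-congˡ (layer-product (tail μ) (suc k) (tail f))))
    (-‿cong (∫ᵉ-factor (μ zero) (f zero) λ x →
      trans (layer-scale (tail μ) k (f zero x) (λ y → ∏.sum (λ i → tail f i (y i)))) (*-congˡ (layer-product (tail μ) k (tail f)))))

  truncated-product : ∀ {n m} (μ : Fin n → Measure m) k (f : Fin n → Point m → ℝ) →
    truncated μ k (λ y → ∏.sum (λ i → f i (y i))) ≈
    truncatedᵖ (λ i → ∫ᶜ (μ i) (f i)) (λ i → ∫ᵉ (μ i) (f i)) k
  truncated-product {zero}  μ k f = refl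
  truncated-product {suc n} μ k f = +-cong
    (∫ᶜ-factor (μ zero) (f zero) λ x →
      trans (truncated-scale (tail μ) k (f zero x) (λ y → ∏.sum (λ i → tail f i (y i)))) (*-congˡ (truncated-product (tail μ) k (tail f))))
    (∫ᵉ-factor (μ zero) (f zero) λ x →
      trans (layer-scale (tail μ) k (f zero x) (λ y → ∏.sum (λ i → tail f i (y i)))) (*-congˡ (layer-product (tail μ) k (tail f))))

  truncatedᵖ-zero : ∀ {n} (c e : Vector ℝ n) → truncatedᵖ c e 0 ≈ layerᵖ c e 0
  truncatedᵖ-zero {zero}  c e = refl
  truncatedᵖ-zero {suc n} c e = trans (+-congʳ (*-congˡ (truncatedᵖ-zero (tail c) (tail e))))
    (solve 3 (λ c e l → c :* l :+ e :* l := (c :+ e) :* l) refl (c zero) (e zero) (layerᵖ (tail c) (tail e) 0))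

  -- The recursions reflect what an added error coordinate does. By Pascal's rule it turns (-1)ᵏ⁺¹
  -- C(z,k+1) into itself minus (-1)ᵏ C(z,k); by telescoping it turns the alternating sum into (-1)ᵏ
  -- C(z,k). This lemma recovers the partial sum of layers from the second recursion.
  truncatedᵖ-suc : ∀ {n} (c e : Vector ℝ n) k → truncatedᵖ c e (suc k) ≈ truncatedᵖ c e k + layerᵖ c e (suc k)
  truncatedᵖ-suc {zero}  c e k = sym (+-identityʳ 1#)
  truncatedᵖ-suc {suc n} c e k = trans (+-congʳ (*-congˡ (truncatedᵖ-suc (tail c) (tail e) k)))
    (solve 5 (λ c e t l l′ → c :* (t :+ l′) :+ e :* l′ := c :* t :+ e :* l :+ ((c :+ e) :* l′ :- e :* l)) refl
      (c zero) (e zero) (truncatedᵖ (tail c) (tail e) k) (layerᵖ (tail c) (tail e) k) (layerᵖ (tail c) (tail e) (suc k)))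

  -- Each term of C(z,k) selects k coordinates and integrates the full measure in the others. As V
  -- has more than k elements, some coordinate of V is left unselected, and its factor c + e is
  -- zero.
  layerᵖ-vanishes : ∀ {n} (c e : Vector ℝ n) k (V : Subset n) → k ℕ.< ∣ V ∣ →
    (∀ i → Vec.lookup V i ≡ true → c i + e i ≈ 0#) → layerᵖ c e k ≈ 0#
  layerᵖ-vanishes {suc n} c e zero (true Vec.∷ V) _ vanish = trans (*-congʳ (vanish zero ≡.refl)) (zeroˡ _)
  layerᵖ-vanishes {suc n} c e (suc k) (true Vec.∷ V) (s≤s k<V) vanish = trans
    (+-cong (*-congʳ (vanish zero ≡.refl)) (-‿cong (*-congˡ (layerᵖ-vanishes (tail c) (tail e) k V k<V (λ i → vanish (suc i))))))
    (solve 2 (λ e l → con (+ 0) :* l :- e :* con (+ 0) := con (+ 0)) refl (e zero) _)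
  layerᵖ-vanishes {suc n} c e zero (false Vec.∷ V) k<V vanish =
    trans (*-congˡ (layerᵖ-vanishes (tail c) (tail e) zero V k<V (λ i → vanish (suc i)))) (zeroʳ _)
  layerᵖ-vanishes {suc n} c e (suc k) (false Vec.∷ V) k<V vanish = trans
    (+-cong (*-congˡ (layerᵖ-vanishes (tail c) (tail e) (suc k) V k<V (λ i → vanish (suc i))))
            (-‿cong (*-congˡ (layerᵖ-vanishes (tail c) (tail e) k V (ℕ.<-trans (ℕ.n<1+n k) k<V) (λ i → vanish (suc i))))))
    (solve 2 (λ c e → (c :+ e) :* con (+ 0) :- e :* con (+ 0) := con (+ 0)) refl (c zero) (e zero))

  -- At a coordinate of V the top layer is split off: it appears with the factor c₀ + e₀ = 0, and
  -- what remains is the same claim with k and V both smaller by one.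
  truncatedᵖ-vanishes : ∀ {n} (c e : Vector ℝ n) k (V : Subset n) → k ℕ.< ∣ V ∣ →
    (∀ i → Vec.lookup V i ≡ true → c i + e i ≈ 0#) → truncatedᵖ c e k ≈ 0#
  truncatedᵖ-vanishes c e zero V k<V vanish = trans (truncatedᵖ-zero c e) (layerᵖ-vanishes c e zero V k<V vanish)
  truncatedᵖ-vanishes {suc n} c e (suc k) (true Vec.∷ V) (s≤s k<V) vanish = begin-equality
    c₀ * truncatedᵖ c′ e′ (suc k) + e₀ * layerᵖ c′ e′ (suc k)
      ≈⟨ +-congʳ (*-congˡ (truncatedᵖ-suc c′ e′ k)) ⟩
    c₀ * (truncatedᵖ c′ e′ k + layerᵖ c′ e′ (suc k)) + e₀ * layerᵖ c′ e′ (suc k)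
      ≈⟨ solve 4 (λ c e t l → c :* (t :+ l) :+ e :* l := c :* t :+ (c :+ e) :* l) refl c₀ e₀ _ _ ⟩
    c₀ * truncatedᵖ c′ e′ k + (c₀ + e₀) * layerᵖ c′ e′ (suc k)
      ≈⟨ +-cong (*-congˡ (truncatedᵖ-vanishes c′ e′ k V k<V (λ i → vanish (suc i)))) (*-congʳ (vanish zero ≡.refl)) ⟩
    c₀ * 0# + 0# * layerᵖ c′ e′ (suc k)
      ≈⟨ solve 2 (λ c l → c :* con (+ 0) :+ con (+ 0) :* l := con (+ 0)) refl c₀ _ ⟩
    0# ∎
    where
    c₀ = c zero
    e₀ = e zero
    c′ = λ i → c (suc i)
    e′ = λ i → e (suc i)
  truncatedᵖ-vanishes {suc n} c e (suc k) (false Vec.∷ V) k<V vanish = trans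
    (+-cong (*-congˡ (truncatedᵖ-vanishes (tail c) (tail e) (suc k) V k<V (λ i → vanish (suc i))))
            (*-congˡ (layerᵖ-vanishes (tail c) (tail e) (suc k) V k<V (λ i → vanish (suc i)))))
    (solve 2 (λ c e → c :* con (+ 0) :+ e :* con (+ 0) := con (+ 0)) refl (c zero) (e zero))

  -- Growth of the bounds per coordinate: 2 for the total mass 1 + δ ≤ 2, and 1 more for the term in
  -- which an error pays a factor δ while k drops by one. Together these are at most 4.
  4# : ℝ
  4# = 1# + 1# + 1# + 1#

  0≤4 : 0# ≤ 4#
  0≤4 = +-nonneg (+-nonneg 0≤2 0≤1) 0≤1

  module _ {δ} (0≤δ : 0# ≤ δ) (δ≤1 : δ ≤ 1#) {m : ℕ} {Low : Vector ℕ m → Set} where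

    ∫ᵉ-bound : ∀ {X : Point m → Set} {g : BooleanFunction X} {μ} → IsDual g δ Low μ → ∀ {f b} → 0# ≤ b →
               (∀ x → X x → abs (f x) ≤ b) → abs (∫ᵉ μ f) ≤ δ * b
    ∫ᵉ-bound {μ = μ} dual 0≤b f≤b = ∫-bound (Measure.error μ) (Measure.point μ) error-small 0≤b (λ j → f≤b (Measure.point μ j) (point∈ j))
      where open IsDual dual

    ∫ᶜ-bound : ∀ {X : Point m → Set} {g : BooleanFunction X} {μ} → IsDual g δ Low μ → ∀ {f b} → 0# ≤ b →
               (∀ x → X x → abs (f x) ≤ b) → abs (∫ᶜ μ f) ≤ 1# * b
    ∫ᶜ-bound {g = g} {μ} dual 0≤b f≤b = ∫-bound (Measure.correct μ) (Measure.point μ)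
      (≤-trans (∑-mono correct≤weight) (≤-reflexive weight-total)) 0≤b (λ j → f≤b (Measure.point μ j) (point∈ j))
      where
      open IsDual dual
      open BooleanFunction g
      correct≤weight : ∀ j → abs (Measure.correct μ j) ≤ weight j
      correct≤weight j with correct-sign j
      ... | inj₁ (w≈0 , c≈0) = ≤-reflexive (trans (abs-cong c≈0) (trans (abs-of-nonneg ≤-refl) (sym w≈0)))
      ... | inj₂ (x∈ , c≈)   = begin
        abs (Measure.correct μ j)     ≈⟨ abs-cong c≈ ⟩
        abs (weight j * ⟦ value (Measure.point μ j) x∈ ⟧)
                                      ≤⟨ abs-*⟦⟧ (weight j) (value (Measure.point μ j) x∈) ⟩
        abs (weight j)                ≈⟨ abs-of-nonneg (weight-nonneg j) ⟩
        weight j                      ∎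

    ∫ᵗ-bound : ∀ {X : Point m → Set} {g : BooleanFunction X} {μ} → IsDual g δ Low μ → ∀ {f b} → 0# ≤ b →
               (∀ x → X x → abs (f x) ≤ b) → abs (∫ᵗ μ f) ≤ (1# + 1#) * b
    ∫ᵗ-bound {μ = μ} dual {f} {b} 0≤b f≤b = begin
      abs (∫ᵗ μ f)                   ≤⟨ abs-triangle _ _ ⟩
      abs (∫ᶜ μ f) + abs (∫ᵉ μ f)    ≤⟨ +-mono-≤ (∫ᶜ-bound dual 0≤b f≤b) (∫ᵉ-bound dual 0≤b f≤b) ⟩
      1# * b + δ * b                 ≤⟨ +-monoʳ-≤ _ (*-monoʳ-≤ 0≤b δ≤1) ⟩
      1# * b + 1# * b                ≈⟨ solve 1 (λ b → con (+ 1) :* b :+ con (+ 1) :* b := con (+ 2) :* b) refl b ⟩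
      (1# + 1#) * b                  ∎

  module _ {δ} (0≤δ : 0# ≤ δ) (δ≤1 : δ ≤ 1#) {m : ℕ} {M} (0≤M : 0# ≤ M) where

    tail-bound : ℕ → ℕ → ℝ
    tail-bound n k = M * (4# ^ n * δ ^ k)

    tail-bound-nonneg : ∀ n k → 0# ≤ tail-bound n k
    tail-bound-nonneg n k = *-nonneg 0≤M (*-nonneg (^-nonneg n 0≤4) (^-nonneg k 0≤δ))

    ∈-cons : ∀ {n} {X : Fin (suc n) → Point m → Set} {x y} → X zero x → (∀ i → X (suc i) (y i)) → ∀ i → X i ((x ∷ y) i)
    ∈-cons x∈ y∈ zero    = x∈
    ∈-cons x∈ y∈ (suc i) = y∈ i

    -- Whenever the recursion lowers k it integrates over an error part, whose mass is at most δ,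
    -- and a term that runs out of coordinates before k reaches 0 contributes nothing. So all k
    -- factors δ are collected.
    layer-bound : ∀ {n} {X : Fin n → Point m → Set} {g : ∀ i → BooleanFunction (X i)}
      {Low : Fin n → Vector ℕ m → Set} {μ} → (∀ i → IsDual (g i) δ (Low i) (μ i)) → ∀ k {F} →
      (∀ y → (∀ i → X i (y i)) → abs (F y) ≤ M) → abs (layer μ k F) ≤ tail-bound n k
    layer-bound {zero} dual zero F≤M = ≤-trans (F≤M [] (λ ()))
      (≤-reflexive (solve 1 (λ M → M := M :* (con (+ 1) :* con (+ 1))) refl M))
    layer-bound {zero} dual (suc k) F≤M =
      ≤-trans (≤-reflexive (abs-of-nonneg ≤-refl)) (tail-bound-nonneg 0 (suc k))
    layer-bound {suc n} {X} {μ = μ} dual zero {F} F≤M = begin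
      abs (layer μ zero F)                ≤⟨ ∫ᵗ-bound 0≤δ δ≤1 (dual zero) (tail-bound-nonneg n 0) (λ x x∈ →
                                               layer-bound (λ i → dual (suc i)) zero (λ y y∈ → F≤M (x ∷ y) (∈-cons {X = X} x∈ y∈))) ⟩
      (1# + 1#) * tail-bound n 0          ≤⟨ from-nonneg (*-nonneg 0≤2 (tail-bound-nonneg n 0))
        (solve 3 (λ M p q → con (+ 2) :* (M :* (p :* q)) := M :* (con (+ 4) :* p :* q) :- con (+ 2) :* (M :* (p :* q)))
          refl M (4# ^ n) 1#) ⟩
      tail-bound (suc n) 0                ∎
    layer-bound {suc n} {X} {μ = μ} dual (suc k) {F} F≤M = begin
      abs (layer μ (suc k) F)
        ≤⟨ abs-triangle _ _ ⟩
      abs (∫ᵗ (μ zero) (λ x → layer (tail μ) (suc k) (slice F x))) + abs (- ∫ᵉ (μ zero) (λ x → layer (tail μ) k (slice F x)))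
        ≤⟨ +-mono-≤
             (∫ᵗ-bound 0≤δ δ≤1 (dual zero) (tail-bound-nonneg n (suc k)) (λ x x∈ →
               layer-bound (λ i → dual (suc i)) (suc k) (λ y y∈ → F≤M (x ∷ y) (∈-cons {X = X} x∈ y∈))))
             (≤-trans (abs-neg _) (∫ᵉ-bound 0≤δ δ≤1 (dual zero) (tail-bound-nonneg n k) (λ x x∈ →
               layer-bound (λ i → dual (suc i)) k (λ y y∈ → F≤M (x ∷ y) (∈-cons {X = X} x∈ y∈))))) ⟩
      (1# + 1#) * tail-bound n (suc k) + δ * tail-bound n k
        ≤⟨ from-nonneg (tail-bound-nonneg n (suc k))
             (solve 4 (λ M p q δ → M :* (p :* (δ :* q)) := M :* (con (+ 4) :* p :* (δ :* q)) :-
                (con (+ 2) :* (M :* (p :* (δ :* q))) :+ δ :* (M :* (p :* q)))) refl M (4# ^ n) (δ ^ k) δ) ⟩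
      tail-bound (suc n) (suc k) ∎

    ⟦⟧-* : ∀ σ τ → ⟦ σ Sign.* τ ⟧ ≈ ⟦ σ ⟧ * ⟦ τ ⟧
    ⟦⟧-* Sign.+ τ      = sym (*-identityˡ _)
    ⟦⟧-* Sign.- Sign.+ = sym (*-identityʳ _)
    ⟦⟧-* Sign.- Sign.- = solve 0 (con (+ 1) := (:- con (+ 1)) :* (:- con (+ 1))) refl

    -- Induction over the coordinates, with σ the product of the signs already fixed. A correct
    -- coordinate multiplies σ by its own sign and keeps b, because the weights sum to 1. An error
    -- coordinate leaves a `layer` integral, so it loses at most δ times the bound on that layer.
    truncated-lower-bound : ∀ {n} {X : Fin n → Point m → Set} {g : ∀ i → BooleanFunction (X i)}
      {Low : Fin n → Vector ℕ m → Set} {μ} → (∀ i → IsDual (g i) δ (Low i) (μ i)) → ∀ k {F} →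
      (∀ y → (∀ i → X i (y i)) → abs (F y) ≤ M) → ∀ σ b →
      (∀ y (y∈ : ∀ i → BooleanFunction.dom (g i) (y i)) →
        b ≤ ⟦ σ ⟧ * ⟦ ∏Sign.sum (λ i → BooleanFunction.value (g i) (y i) (y∈ i)) ⟧ * F y) →
      b - tail-bound n (suc k) ≤ ⟦ σ ⟧ * truncated μ k F
    truncated-lower-bound {zero} dual k {F} F≤M σ b correlated = begin
      b - tail-bound 0 (suc k)    ≤⟨ from-nonneg (tail-bound-nonneg 0 (suc k)) (solve 2 (λ b t → t := b :- (b :- t)) refl b _) ⟩
      b                           ≤⟨ correlated [] (λ ()) ⟩
      ⟦ σ ⟧ * 1# * F []           ≈⟨ *-congʳ (*-identityʳ _) ⟩
      ⟦ σ ⟧ * F []                ∎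
    truncated-lower-bound {suc n} {X} {g} {μ = μ} dual k {F} F≤M σ b correlated = begin
      b - tail-bound (suc n) (suc k)
        ≤⟨ from-nonneg (*-nonneg 0≤2 (tail-bound-nonneg n (suc k)))
             (solve 5 (λ M p q δ b → con (+ 2) :* (M :* (p :* (δ :* q))) :=
                (b :- M :* (p :* (δ :* q)) :- δ :* (M :* (p :* q))) :- (b :- M :* (con (+ 4) :* p :* (δ :* q))))
                refl M (4# ^ n) (δ ^ k) δ b) ⟩
      b - tail-bound n (suc k) - δ * tail-bound n k
        ≤⟨ +-mono-≤ correct-part (neg-mono error-part) ⟩
      ⟦ σ ⟧ * ∫ᶜ (μ zero) inner - - (⟦ σ ⟧ * ∫ᵉ (μ zero) outer)
        ≈⟨ solve 3 (λ s x y → s :* x :- (:- (s :* y)) := s :* (x :+ y)) refl ⟦ σ ⟧ _ _ ⟩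
      ⟦ σ ⟧ * truncated μ k F ∎
      where
      open IsDual (dual zero)
      open Measure (μ zero)
      inner outer : Point m → ℝ
      inner x = truncated (tail μ) k (slice F x)
      outer x = layer (tail μ) k (slice F x)

      error-part : - (⟦ σ ⟧ * ∫ᵉ (μ zero) outer) ≤ δ * tail-bound n k
      error-part = begin
        - (⟦ σ ⟧ * ∫ᵉ (μ zero) outer)      ≤⟨ -x≤abs _ ⟩
        abs (⟦ σ ⟧ * ∫ᵉ (μ zero) outer)    ≈⟨ abs-cong (*-comm _ _) ⟩
        abs (∫ᵉ (μ zero) outer * ⟦ σ ⟧)    ≤⟨ abs-*⟦⟧ _ σ ⟩
        abs (∫ᵉ (μ zero) outer)            ≤⟨ ∫ᵉ-bound 0≤δ δ≤1 (dual zero) (tail-bound-nonneg n k) (λ x x∈ →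
                                                layer-bound (λ i → dual (suc i)) k (λ y y∈ → F≤M (x ∷ y) (∈-cons {X = X} x∈ y∈))) ⟩
        δ * tail-bound n k                 ∎

      b′ = b - tail-bound n (suc k)

      inner-bound : ∀ {x} (x∈ : BooleanFunction.dom (g zero) x) → X zero x →
                    b′ ≤ ⟦ σ Sign.* BooleanFunction.value (g zero) x x∈ ⟧ * inner x
      inner-bound {x} x∈ x∈X = truncated-lower-bound (λ i → dual (suc i)) k (λ y y∈ → F≤M (x ∷ y) (∈-cons {X = X} x∈X y∈)) (σ Sign.* v) b λ y y∈ → begin
        b                                      ≤⟨ correlated (x ∷ y) (∈-cons {X = λ i → BooleanFunction.dom (g i)} x∈ y∈) ⟩
        ⟦ σ ⟧ * ⟦ v Sign.* w y y∈ ⟧ * F (x ∷ y)     ≈⟨ *-congʳ (begin-equality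
            ⟦ σ ⟧ * ⟦ v Sign.* w y y∈ ⟧                ≈⟨ *-congˡ (⟦⟧-* v (w y y∈)) ⟩
            ⟦ σ ⟧ * (⟦ v ⟧ * ⟦ w y y∈ ⟧)               ≈⟨ *-assoc _ _ _ ⟨
            ⟦ σ ⟧ * ⟦ v ⟧ * ⟦ w y y∈ ⟧                 ≈⟨ *-congʳ (⟦⟧-* σ v) ⟨
            ⟦ σ Sign.* v ⟧ * ⟦ w y y∈ ⟧                ∎) ⟩
        ⟦ σ Sign.* v ⟧ * ⟦ w y y∈ ⟧ * F (x ∷ y)     ∎
        where
        v = BooleanFunction.value (g zero) x x∈
        w : ∀ y → (∀ i → BooleanFunction.dom (g (suc i)) (y i)) → Sign
        w y y∈ = ∏Sign.sum (λ i → BooleanFunction.value (g (suc i)) (y i) (y∈ i))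

      term-bound : ∀ j → weight j * b′ ≤ ⟦ σ ⟧ * (correct j * inner (point j))
      term-bound j with correct-sign j
      ... | inj₁ (w≈0 , c≈0) = ≤-reflexive (begin-equality
        weight j * b′                              ≈⟨ *-congʳ w≈0 ⟩
        0# * b′                                    ≈⟨ solve 3 (λ b s x → con (+ 0) :* b := s :* (con (+ 0) :* x)) refl b′ ⟦ σ ⟧ (inner (point j)) ⟩
        ⟦ σ ⟧ * (0# * inner (point j))             ≈⟨ *-congˡ (*-congʳ c≈0) ⟨
        ⟦ σ ⟧ * (correct j * inner (point j))      ∎)
      ... | inj₂ (x∈ , c≈) = begin
        weight j * b′                              ≤⟨ *-monoˡ-≤ (weight-nonneg j) (inner-bound x∈ (point∈ j)) ⟩
        weight j * (⟦ σ Sign.* v ⟧ * inner (point j))    ≈⟨ *-congˡ (*-congʳ (⟦⟧-* σ v)) ⟩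
        weight j * (⟦ σ ⟧ * ⟦ v ⟧ * inner (point j))     ≈⟨ solve 4 (λ w s v x → w :* (s :* v :* x) := s :* (w :* v :* x)) refl
                                                             (weight j) ⟦ σ ⟧ ⟦ v ⟧ (inner (point j)) ⟩
        ⟦ σ ⟧ * (weight j * ⟦ v ⟧ * inner (point j))     ≈⟨ *-congˡ (*-congʳ c≈) ⟨
        ⟦ σ ⟧ * (correct j * inner (point j))      ∎
        where v = BooleanFunction.value (g zero) (point j) x∈

      correct-part : b′ ≤ ⟦ σ ⟧ * ∫ᶜ (μ zero) inner
      correct-part = begin
        b′                                                      ≈⟨ *-identityˡ b′ ⟨
        1# * b′                                                 ≈⟨ *-congʳ weight-total ⟨
        ∑.sum weight * b′                                       ≈⟨ *-distribʳ-sum b′ weight ⟩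
        ∑.sum (λ j → weight j * b′)                             ≤⟨ ∑-mono term-bound ⟩
        ∑.sum (λ j → ⟦ σ ⟧ * (correct j * inner (point j)))     ≈⟨ *-distribˡ-sum ⟦ σ ⟧ (λ j → correct j * inner (point j)) ⟨
        ⟦ σ ⟧ * ∑.sum (λ j → correct j * inner (point j))       ≈⟨ *-congˡ (∫-unfold correct point inner) ⟨
        ⟦ σ ⟧ * ∫ᶜ (μ zero) inner                               ∎

-- Sums over blocks, choice of coordinates, and integer rounding.

module _ {c ℓ} (M : CommutativeMonoid c ℓ) where
  open CommutativeMonoid M
  open Sum M using (sum; sum-cong-≋)

  sum-++ : ∀ m {n} (f : Vector Carrier (m ℕ.+ n)) →
           sum f ≈ sum (λ i → f (i ↑ˡ n)) ∙ sum (λ j → f (m ↑ʳ j))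
  sum-++ zero    f = sym (identityˡ _)
  sum-++ (suc m) f = trans (∙-congˡ (sum-++ m (tail f))) (sym (assoc _ _ _))

  sum-combine : ∀ n m (f : Vector Carrier (n ℕ.* m)) →
                sum f ≈ sum (λ i → sum (λ j → f (combine {n} {m} i j)))
  sum-combine zero    m f = refl
  sum-combine (suc n) m f = trans (sum-++ m f) (∙-congˡ (sum-combine n m (λ k → f (m ↑ʳ k))))

∑-block-degrees : ∀ {n m} K (α : Vector ℕ (n ℕ.* m)) →
  ∑ℕ.sum (λ i → K ℕ.* ∑ℕ.sum (λ j → α (combine {n} {m} i j))) ≡ K ℕ.* ∑ℕ.sum α
∑-block-degrees {n} {m} K α = ≡.trans
  (≡.sym (ℕ∑.*-distribˡ-sum K (λ i → ∑ℕ.sum (λ j → α (combine {n} {m} i j)))))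
  (≡.cong (K ℕ.*_) (≡.sym (sum-combine ℕ.+-0-commutativeMonoid n m α)))
  where module ℕ∑ = SemiringSum ℕ.+-*-semiring

-- A greedy scan puts the first q coordinates with b ≤ a into S. If there are fewer than q of these,
-- the coordinates with a < b number more than n - q and form V. With a the scaled block degrees of
-- a monomial, V consists of blocks where it is orthogonal to the dual measure.
subset-alternative : ∀ {n} q (a b : Vector ℕ n) →
  (∃ λ (S : Subset n) → ∣ S ∣ ≡ q × ∑[ S ] b ℕ.≤ ∑ℕ.sum a) ⊎
  (∃ λ (V : Subset n) → n ℕ.< ∣ V ∣ ℕ.+ q × (∀ i → Vec.lookup V i ≡ true → a i ℕ.< b i))
subset-alternative {n} zero a b = inj₁ (⊥ , ∣⊥∣≡0 n , ℕ.≤-trans (ℕ.≤-reflexive (∑-⊥ b)) z≤n)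
  where
  ∑-⊥ : ∀ {n} (b : Vector ℕ n) → ∑[ ⊥ ] b ≡ 0
  ∑-⊥ {zero}  b = ≡.refl
  ∑-⊥ {suc n} b = ∑-⊥ (tail b)
subset-alternative {zero}  (suc q) a b = inj₂ (Vec.[] , s≤s z≤n , λ ())
subset-alternative {suc n} (suc q) a b with a zero ℕ.<? b zero
... | yes a₀<b₀ with subset-alternative (suc q) (tail a) (tail b)
...   | inj₁ (S , ∣S∣≡q , b≤a) = inj₁ (false Vec.∷ S , ∣S∣≡q , ℕ.m≤n⇒m≤o+n (a zero) b≤a)
...   | inj₂ (V , n<V , a<b)   = inj₂ (true Vec.∷ V , s≤s n<V , λ { zero _ → a₀<b₀ ; (suc i) i∈ → a<b i i∈ })
subset-alternative {suc n} (suc q) a b | no a₀≮b₀ with subset-alternative q (tail a) (tail b)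
...   | inj₁ (S , ∣S∣≡q , b≤a) = inj₁ (true Vec.∷ S , ≡.cong suc ∣S∣≡q , ℕ.+-mono-≤ (ℕ.≮⇒≥ a₀≮b₀) b≤a)
...   | inj₂ (V , n<V , a<b)   = inj₂ (false Vec.∷ V , ≡.subst (suc n ℕ.<_) (≡.sym (ℕ.+-suc ∣ V ∣ q)) (s≤s n<V) ,
                                       λ { (suc i) i∈ → a<b i i∈ })

-- Write n = b + a with a = ⌊n/100⌋. Then 99 a ≤ b, so 99 n ≤ 100 b and the ceiling is at most b.
⌈99n/100⌉+n/100≤n : ∀ n → ⌈ 99 ℕ.* n / 100 ⌉ ℕ.+ n ℕ./ 100 ℕ.≤ n
⌈99n/100⌉+n/100≤n n = begin
  ⌈ 99 ℕ.* n / 100 ⌉ ℕ.+ a   ≤⟨ ℕ.+-monoˡ-≤ a (ℕ.s≤s⁻¹ (ℕ.m<n*o⇒m/o<n 99n+99<)) ⟩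
  b ℕ.+ a                    ≡⟨ b+a≡n ⟩
  n                          ∎
  where
  open ℕ.≤-Reasoning
  a = n ℕ./ 100
  b = n ℕ.∸ a
  b+a≡n : b ℕ.+ a ≡ n
  b+a≡n = ℕ.m∸n+n≡m (ℕ.m/n≤m n 100)
  99a≤b : 99 ℕ.* a ℕ.≤ b
  99a≤b = ℕ.+-cancelʳ-≤ a (99 ℕ.* a) b (begin
    99 ℕ.* a ℕ.+ a   ≡⟨ ℕ.+-comm (99 ℕ.* a) a ⟩
    100 ℕ.* a        ≡⟨ ℕ.*-comm 100 a ⟩
    a ℕ.* 100        ≤⟨ ℕ.m/n*n≤m n 100 ⟩
    n                ≡⟨ b+a≡n ⟨
    b ℕ.+ a          ∎)
  99n+99< : 99 ℕ.* n ℕ.+ 99 ℕ.< suc b ℕ.* 100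
  99n+99< = begin-strict
    99 ℕ.* n ℕ.+ 99                       ≡⟨ ≡.cong (λ n → 99 ℕ.* n ℕ.+ 99) b+a≡n ⟨
    99 ℕ.* (b ℕ.+ a) ℕ.+ 99               ≡⟨ ≡.cong (ℕ._+ 99) (ℕ.*-distribˡ-+ 99 b a) ⟩
    99 ℕ.* b ℕ.+ 99 ℕ.* a ℕ.+ 99          ≤⟨ ℕ.+-monoˡ-≤ 99 (ℕ.+-monoʳ-≤ (99 ℕ.* b) 99a≤b) ⟩
    99 ℕ.* b ℕ.+ b ℕ.+ 99                 <⟨ ℕ.+-monoʳ-< (99 ℕ.* b ℕ.+ b) (ℕ.n<1+n 99) ⟩
    99 ℕ.* b ℕ.+ b ℕ.+ 100                ≡⟨ ≡.cong (ℕ._+ 100) (ℕ.+-comm (99 ℕ.* b) b) ⟩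
    100 ℕ.* b ℕ.+ 100                     ≡⟨ ℕ.+-comm (100 ℕ.* b) 100 ⟩
    100 ℕ.+ 100 ℕ.* b                     ≡⟨ ≡.cong (100 ℕ.+_) (ℕ.*-comm 100 b) ⟩
    suc b ℕ.* 100                         ∎

n<100*[1+n/100] : ∀ n → n ℕ.< 100 ℕ.* suc (n ℕ./ 100)
n<100*[1+n/100] n = begin-strict
  n                                       ≡⟨ ℕ.m≡m%n+[m/n]*n n 100 ⟩
  n ℕ.% 100 ℕ.+ n ℕ./ 100 ℕ.* 100         <⟨ ℕ.+-monoˡ-< (n ℕ./ 100 ℕ.* 100) (ℕ.m%n<n n 100) ⟩
  100 ℕ.+ n ℕ./ 100 ℕ.* 100               ≡⟨ ℕ.*-comm (suc (n ℕ./ 100)) 100 ⟩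
  100 ℕ.* suc (n ℕ./ 100)                 ∎
  where open ℕ.≤-Reasoning

K*[e/K]≤e : ∀ K e .{{_ : ℕ.NonZero K}} → K ℕ.* (e ℕ./ K) ℕ.≤ e
K*[e/K]≤e K e = ℕ.≤-trans (ℕ.≤-reflexive (ℕ.*-comm K (e ℕ./ K))) (ℕ.m/n*n≤m e K)

K*m≤e⇒m≤e/K : ∀ K m {e} .{{_ : ℕ.NonZero K}} → K ℕ.* m ℕ.≤ e → m ℕ.≤ e ℕ./ K
K*m≤e⇒m≤e/K K m {e} K*m≤e = begin
  m                 ≡⟨ ℕ.m*n/n≡m m K ⟨
  m ℕ.* K ℕ./ K     ≡⟨ ≡.cong (ℕ._/ K) (ℕ.*-comm m K) ⟩
  K ℕ.* m ℕ./ K     ≤⟨ ℕ./-monoˡ-≤ K K*m≤e ⟩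
  e ℕ./ K           ∎
  where open ℕ.≤-Reasoning

-- Choice of constants and the degree bound.

module Main (em : ExcludedMiddle 0ℓ) (R : RealNumbers) where
  open OrderedField R
  open Polynomials R
  open ErrorReduction em R using (error-reduction)
  open DualMeasures em R
  open ProductMeasure em R

  join : ∀ {n m} → (Fin n → Point m) → Point (n ℕ.* m)
  join {n} {m} y k = let i , j = remQuot {n} m k in y i j

  block-join : ∀ {n m} (y : Fin n → Point m) i → block i (join y) ≋ y i
  block-join {n} {m} y i j = reflexive (≡.cong (λ (i′ , j′) → y i′ j′) (remQuot-combine {n} {m} i j))

  monomial-join : ∀ {n m} (α : Vector ℕ (n ℕ.* m)) (y : Fin n → Point m) →
    monomial α (join y) ≈ ∏.sum (λ i → monomial (λ j → α (combine i j)) (y i))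
  monomial-join {n} {m} α y = trans (sum-combine *-commutativeMonoid n m _)
    (∏.sum-cong-≋ (λ i → ∏.sum-cong-≋ (λ j → ^-congˡ (α (combine i j)) (block-join y i j))))

  -- A monomial is a product over the blocks, so its integral is a `truncatedᵖ` of block integrals.
  -- The set V may be different for each monomial of p.
  truncated-eval-vanishes : ∀ {n m k} (μ : Fin n → Measure m) (p : Polynomial (n ℕ.* m)) →
    All (λ (_ , α) → ∃ λ (V : Subset n) → k ℕ.< ∣ V ∣ ×
      (∀ i → Vec.lookup V i ≡ true → ∫ᵗ (μ i) (monomial (λ j → α (combine i j))) ≈ 0#)) p →
    truncated μ k (λ y → eval p (join y)) ≈ 0#
  truncated-eval-vanishes {k = k} μ List.[] All.[] = truncated-zero μ k
  truncated-eval-vanishes {k = k} μ ((c , α) List.∷ p) ((V , k<V , vanish) All.∷ rest) = begin-equality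
    truncated μ k (λ y → c * monomial α (join y) + eval p (join y))
      ≈⟨ truncated-linear μ k c (λ y → monomial α (join y)) (λ y → eval p (join y)) ⟩
    c * truncated μ k (λ y → monomial α (join y)) + truncated μ k (λ y → eval p (join y))
      ≈⟨ +-cong (*-congˡ (begin-equality
           truncated μ k (λ y → monomial α (join y))
             ≈⟨ truncated-cong μ k (monomial-join α) ⟩
           truncated μ k (λ y → ∏.sum (λ i → monomial (λ j → α (combine i j)) (y i)))
             ≈⟨ truncated-product μ k (λ i → monomial (λ j → α (combine i j))) ⟩
           truncatedᵖ (λ i → ∫ᶜ (μ i) (monomial (λ j → α (combine i j)))) (λ i → ∫ᵉ (μ i) (monomial (λ j → α (combine i j)))) k
             ≈⟨ truncatedᵖ-vanishes _ _ k V k<V vanish ⟩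
           0# ∎)) (truncated-eval-vanishes μ p rest) ⟩
    c * 0# + 0#
      ≈⟨ solve 1 (λ c → c :* con (+ 0) :+ con (+ 0) := con (+ 0)) refl c ⟩
    0# ∎

  ⟦⟧-correlation : ∀ σ {x ε} → abs (⟦ σ ⟧ - x) ≤ ε → 1# - ε ≤ ⟦ σ ⟧ * x
  ⟦⟧-correlation Sign.+ {x} {ε} close = from-nonneg (to-nonneg (≤-trans (x≤abs _) close))
    (solve 2 (λ x ε → ε :- (con (+ 1) :- x) := con (+ 1) :* x :- (con (+ 1) :- ε)) refl x ε)
  ⟦⟧-correlation Sign.- {x} {ε} close = from-nonneg (to-nonneg (≤-trans (-x≤abs _) close))
    (solve 2 (λ x ε → ε :- (:- ((:- con (+ 1)) :- x)) := (:- con (+ 1)) :* x :- (con (+ 1) :- ε)) refl x ε)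

  ⟦⟧-magnitude : ∀ σ {x ε} → abs (⟦ σ ⟧ - x) ≤ ε → abs x ≤ 1# + ε
  ⟦⟧-magnitude σ {x} {ε} close = begin
    abs x                                ≈⟨ abs-cong (solve 2 (λ s x → x := s :+ (:- (s :- x))) refl ⟦ σ ⟧ x) ⟩
    abs (⟦ σ ⟧ + - (⟦ σ ⟧ - x))          ≤⟨ abs-triangle _ _ ⟩
    abs ⟦ σ ⟧ + abs (- (⟦ σ ⟧ - x))      ≤⟨ +-mono-≤ (abs-⟦⟧ σ) (≤-trans (abs-neg _) close) ⟩
    1# + ε                               ∎

  module _ {β} (0<β : 0# < β) (β≤1 : β ≤ 1#) where
    private
      0<4 : 0# < 4#
      0<4 = +-pos-nonneg (+-pos-nonneg (+-pos-nonneg 0<1 0≤1) 0≤1) 0≤1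

      -- Chosen so that γⁿ turns the growth 4ⁿ of the bounds into βⁿ.
      γ = 4# ⁻¹ * β

      0<γ : 0# < γ
      0<γ = *-pos (⁻¹-pos 0<4) 0<β

      4γ≈β : 4# * γ ≈ β
      4γ≈β = trans (solve 3 (λ x y z → x :* (y :* z) := y :* (x :* z)) refl 4# (4# ⁻¹) β) (cancel-inverse β 0<4)

      γ<1 : γ < 1#
      γ<1 = <-≤-trans (γ≤4γ , λ γ≈4γ → proj₂ (*-pos 0<3 0<γ) (begin-equality
          0#                      ≈⟨ solve 1 (λ γ → con (+ 0) := γ :- γ) refl γ ⟩
          γ - γ                   ≈⟨ +-congʳ γ≈4γ ⟩
          4# * γ - γ              ≈⟨ solve 1 (λ γ → con (+ 4) :* γ :- γ := con (+ 3) :* γ) refl γ ⟩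
          (1# + 1# + 1#) * γ      ∎))
        (≤-trans (≤-reflexive 4γ≈β) β≤1)
        where
        0<3 : 0# < 1# + 1# + 1#
        0<3 = +-pos-nonneg (+-pos-nonneg 0<1 0≤1) 0≤1
        γ≤4γ : γ ≤ 4# * γ
        γ≤4γ = from-nonneg (proj₁ (*-pos 0<3 0<γ))
          (solve 1 (λ γ → con (+ 3) :* γ := con (+ 4) :* γ :- γ) refl γ)

    -- The exponent N (k+1) is at least n + 1: n powers of γ cancel 4ⁿ and leave βⁿ, and the spare
    -- one gives the factor 2γ ≤ 1/2, which makes the tail strictly smaller than βⁿ.
    tail-small : ∀ N n k → n ℕ.< N ℕ.* suc k →
                 ¬ β ^ n ≤ (1# + 1#) * (4# ^ n * (γ ^ N) ^ suc k)
    tail-small N n k n<N[1+k] β^n≤ = <⇒≱ (*-pos (*-pos 0<2 0<γ) (^-pos n 0<β)) (from-nonneg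
      (+-nonneg (to-nonneg β^n≤2γβ^n) (*-nonneg (to-nonneg β≤1) (^-nonneg n (proj₁ 0<β))))
      (begin-equality
        (1# + 1#) * γ * B - B + (1# - β) * B             ≈⟨ +-congˡ (*-congʳ (+-congˡ (-‿cong 4γ≈β))) ⟨
        (1# + 1#) * γ * B - B + (1# - 4# * γ) * B        ≈⟨ solve 2 (λ γ B → con (+ 2) :* γ :* B :- B :+ (con (+ 1) :- con (+ 4) :* γ) :* B :=
                                                              con (+ 0) :- con (+ 2) :* γ :* B) refl γ B ⟩
        0# - (1# + 1#) * γ * B                           ∎))
      where
      B = β ^ n
      0<2 : 0# < 1# + 1#
      0<2 = +-pos-nonneg 0<1 0≤1
      β^n≤2γβ^n : B ≤ (1# + 1#) * γ * B
      β^n≤2γβ^n = begin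
        B                                            ≤⟨ β^n≤ ⟩
        (1# + 1#) * (4# ^ n * (γ ^ N) ^ suc k)       ≈⟨ *-congˡ (*-congˡ (^-assocʳ γ N (suc k))) ⟩
        (1# + 1#) * (4# ^ n * γ ^ (N ℕ.* suc k))     ≤⟨ *-monoˡ-≤ 0≤2 (*-monoˡ-≤ (^-nonneg n 0≤4)
                                                          (^-antimono {γ} {suc n} {N ℕ.* suc k} (proj₁ 0<γ) (proj₁ γ<1) n<N[1+k])) ⟩
        (1# + 1#) * (4# ^ n * (γ * γ ^ n))           ≈⟨ solve 4 (λ t p g q → t :* (p :* (g :* q)) := t :* g :* (p :* q)) refl
                                                          (1# + 1#) (4# ^ n) γ (γ ^ n) ⟩
        (1# + 1#) * γ * (4# ^ n * γ ^ n)             ≈⟨ *-congˡ (^-distrib-* 4# γ n) ⟨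
        (1# + 1#) * γ * (4# * γ) ^ n                 ≈⟨ *-congˡ (^-congˡ n 4γ≈β) ⟩
        (1# + 1#) * γ * B                            ∎

    module _ (N : ℕ) (1≤N : 1 ℕ.≤ N) where
      private
        δ = γ ^ N
        0<δ : 0# < δ
        0<δ = ^-pos N 0<γ
        0≤δ = proj₁ 0<δ
        δ<1 : δ < 1#
        δ<1 = let δ≤γ = ≤-trans (^-antimono {γ} {1} {N} (proj₁ 0<γ) (proj₁ γ<1) 1≤N) (≤-reflexive (*-identityʳ γ))
          in ≤-trans δ≤γ (proj₁ γ<1) , λ δ≈1 → <⇒≱ γ<1 (≤-trans (≤-reflexive (sym δ≈1)) δ≤γ)

      -- For d = e + 1 such a p has degree at most ⌊e/K⌋, so error reduction would give an
      -- approximant with error 1/3 and degree at most K ⌊e/K⌋ ≤ e, below the least possible.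
      low-degree-infeasible : ∀ {m} {X : Pred (Point m) 0ℓ} {g : BooleanFunction X} {d} K → 1 ℕ.≤ K →
        (∀ {e p} → DegreeAtMost e p → Approximates (1# - δ) g p → ∃ λ q → DegreeAtMost (K ℕ.* e) q × Approximates ⅓ g q) →
        IsDeg ⅓ g d → ∀ p → All (λ (_ , α) → K ℕ.* ∑ℕ.sum α ℕ.< d) p → ¬ Approximates (1# - δ) g p
      -- For d = 0 only the empty polynomial has all exponents low. It evaluates to 0, at distance 1
      -- > 1 - δ from the value at a point of the nonempty domain.
      low-degree-infeasible {g = g} {zero} K 1≤K reduce _ List.[] _ approx = <⇒≱ 0<δ (from-nonneg
          (to-nonneg 1≤1-δ) (solve 1 (λ δ → (con (+ 1) :- δ) :- con (+ 1) := con (+ 0) :- δ) refl δ))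
        where
        open BooleanFunction g
        1≤1-δ : 1# ≤ 1# - δ
        1≤1-δ = let x , x∈ = dom-nonempty ; σ = value x x∈ in begin
          1#                           ≈⟨ abs-of-nonneg 0≤1 ⟨
          abs 1#                       ≈⟨ abs-cong (⟦⟧-square σ) ⟨
          abs (⟦ σ ⟧ * ⟦ σ ⟧)          ≤⟨ abs-*⟦⟧ ⟦ σ ⟧ σ ⟩
          abs ⟦ σ ⟧                    ≈⟨ abs-cong (solve 1 (λ s → s := s :- con (+ 0)) refl ⟦ σ ⟧) ⟩
          abs (⟦ σ ⟧ - 0#)             ≤⟨ Approximates.close approx x x∈ ⟩
          1# - δ                       ∎
      low-degree-infeasible {d = zero} K 1≤K reduce _ (_ List.∷ _) (() All.∷ _)
      low-degree-infeasible {d = suc e} K@(suc _) 1≤K reduce (_ , least) p low approx =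
        let q , q≤ , q-approx = reduce (Alls.map (λ { {_ , α} (s≤s Kα≤e) → K*m≤e⇒m≤e/K K (∑ℕ.sum α) Kα≤e }) low) approx
        in ℕ.<⇒≱ (least _ (q , q≤ , q-approx)) (K*[e/K]≤e K e)

      -- The first inequality on q and k turns |V| > n - q into |V| > k, which orthogonality
      -- requires; the second makes the tail negligible.
      degree-bound : ∀ K → 1 ℕ.≤ K →
        (∀ {m} {X : Pred (Point m) 0ℓ} {e} {g : BooleanFunction X} {p} →
         DegreeAtMost e p → Approximates (1# - δ) g p → ∃ λ q → DegreeAtMost (K ℕ.* e) q × Approximates ⅓ g q) →
        ∀ {n m} q k → q ℕ.+ k ℕ.≤ n → n ℕ.< N ℕ.* suc k →
        (X : Fin n → Pred (Point m) 0ℓ) → (∀ i → IsFiniteSet (X i)) → (g : ∀ i → BooleanFunction (X i)) →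
        ∀ d → IsDeg (1# - β ^ n) (⨂ g) d → (dᵢ : Fin n → ℕ) → (∀ i → IsDeg ⅓ (g i) (dᵢ i)) →
        ∀ s → IsMinSubsetSum q dᵢ s → s ℕ.≤ K ℕ.* d
      degree-bound K 1≤K reduce {n} {m} q k q+k≤n n<N[1+k] X X-finite g d ((P , P≤d , P-approx) , _) dᵢ dᵢ-deg s (_ , s-least) =
        ℕ.≮⇒≥ λ Kd<s → tail-small N n k n<N[1+k] (from-nonneg (to-nonneg lower) (begin-equality
          ⟦ Sign.+ ⟧ * truncated μ k F - (β ^ n - (1# + 1#) * (4# ^ n * δ ^ suc k))
            ≈⟨ +-congʳ (*-congˡ (truncated-eval-vanishes μ P (Alls.map (λ { {_ , α} → vanishing Kd<s α }) P≤d))) ⟩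
          1# * 0# - (β ^ n - (1# + 1#) * (4# ^ n * δ ^ suc k))
            ≈⟨ solve 2 (λ b t → con (+ 1) :* con (+ 0) :- (b :- t) := t :- b) refl (β ^ n) _ ⟩
          (1# + 1#) * (4# ^ n * δ ^ suc k) - β ^ n ∎))
        where
        module G i = BooleanFunction (g i)
        open Approximates P-approx

        Low : Fin n → Vector ℕ m → Set
        Low i α = K ℕ.* ∑ℕ.sum α ℕ.< dᵢ i

        duals : ∀ i → ∃ (IsDual (g i) δ (Low i))
        duals i = dual-measure (X-finite i) (g i) δ<1 0≤δ (Low i)
          (low-degree-infeasible K 1≤K reduce (dᵢ-deg i))

        μ : Fin n → Measure m
        μ i = proj₁ (duals i)

        F : (Fin n → Point m) → ℝ
        F y = eval P (join y)

        join∈dom : ∀ y → (∀ i → G.dom i (y i)) → ∀ i → G.dom i (block i (join y))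
        join∈dom y y∈ i = G.dom-respects i (λ j → sym (block-join y i j)) (y∈ i)

        product-value : ∀ y → (∀ i → G.dom i (y i)) → Sign
        product-value y y∈ = ∏Sign.sum (λ i → G.value i (y i) (y∈ i))

        close-on-dom : ∀ y (y∈ : ∀ i → G.dom i (y i)) →
          abs (⟦ product-value y y∈ ⟧ - F y) ≤ 1# - β ^ n
        close-on-dom y y∈ = ≤-trans
          (≤-reflexive (abs-cong (+-congʳ (reflexive (≡.cong ⟦_⟧ (∏Sign.sum-cong-≗ λ i →
            G.value-cong i (y∈ i) (join∈dom y y∈ i) (λ j → sym (block-join y i j))))))))
          (close (join y) (join∈dom y y∈))

        F≤2-β^n : ∀ y → (∀ i → X i (y i)) → abs (F y) ≤ 1# + (1# - β ^ n)
        F≤2-β^n y y∈X with em {∀ i → G.dom i (y i)}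
        ... | yes y∈ = ⟦⟧-magnitude (product-value y y∈) (close-on-dom y y∈)
        ... | no y∉  = bounded (join y)
          (λ i → IsFiniteSet.respects (X-finite i) (λ j → sym (block-join y i j)) (y∈X i))
          (λ join∈ → y∉ λ i → G.dom-respects i (block-join y i) (join∈ i))

        -- This bound is the factor 2 in `tail-small`.
        F≤2 : ∀ y → (∀ i → X i (y i)) → abs (F y) ≤ 1# + 1#
        F≤2 y y∈X = ≤-trans (F≤2-β^n y y∈X) (from-nonneg (^-nonneg n (proj₁ 0<β))
          (solve 1 (λ b → b := con (+ 2) :- (con (+ 1) :+ (con (+ 1) :- b))) refl (β ^ n)))

        lower : β ^ n - (1# + 1#) * (4# ^ n * δ ^ suc k) ≤ ⟦ Sign.+ ⟧ * truncated μ k F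
        lower = truncated-lower-bound 0≤δ (proj₁ δ<1) 0≤2 (λ i → proj₂ (duals i)) k F≤2 Sign.+ (β ^ n) λ y y∈ → begin
          β ^ n                        ≈⟨ solve 1 (λ b → b := con (+ 1) :- (con (+ 1) :- b)) refl (β ^ n) ⟩
          1# - (1# - β ^ n)            ≤⟨ ⟦⟧-correlation (product-value y y∈) (close-on-dom y y∈) ⟩
          ⟦ product-value y y∈ ⟧ * F y         ≈⟨ *-congʳ (*-identityˡ _) ⟨
          1# * ⟦ product-value y y∈ ⟧ * F y    ∎

        vanishing : K ℕ.* d ℕ.< s → ∀ α → ∑ℕ.sum α ℕ.≤ d → ∃ λ (V : Subset n) → k ℕ.< ∣ V ∣ ×
          (∀ i → Vec.lookup V i ≡ true → ∫ᵗ (μ i) (monomial (λ j → α (combine i j))) ≈ 0#)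
        -- If q blocks had K times their degree at least dᵢ, then s ≤ Σ dᵢ over these blocks ≤ K |α|
        -- ≤ K d, against the assumption.
        vanishing Kd<s α α≤d = [ (λ (S , ∣S∣≡q , dᵢ≤) → contradiction Kd<s (ℕ.≤⇒≯ (ℕ.≤-trans (s-least _ (S , ∣S∣≡q , ≡.refl))
              (ℕ.≤-trans dᵢ≤ (ℕ.≤-trans (ℕ.≤-reflexive (∑-block-degrees {n} {m} K α)) (ℕ.*-monoʳ-≤ K α≤d))))))
          , (λ (V , n<V+q , low) → V ,
              ℕ.+-cancelʳ-< q k ∣ V ∣ (ℕ.≤-<-trans (ℕ.≤-trans (ℕ.≤-reflexive (ℕ.+-comm k q)) q+k≤n) n<V+q) ,
              λ i i∈V → IsDual.orthogonal (proj₂ (duals i)) (λ j → α (combine i j)) (low i i∈V))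
          ]′ (subset-alternative q (λ i → K ℕ.* ∑ℕ.sum (λ j → α (combine i j))) dᵢ)

      degree-bound-constant : ∃ λ K → 1 ℕ.≤ K ×
        (∀ {n m} q k → q ℕ.+ k ℕ.≤ n → n ℕ.< N ℕ.* suc k →
         (X : Fin n → Pred (Point m) 0ℓ) → (∀ i → IsFiniteSet (X i)) → (g : ∀ i → BooleanFunction (X i)) →
         ∀ d → IsDeg (1# - β ^ n) (⨂ g) d → (dᵢ : Fin n → ℕ) → (∀ i → IsDeg ⅓ (g i) (dᵢ i)) →
         ∀ s → IsMinSubsetSum q dᵢ s → s ℕ.≤ K ℕ.* d)
      degree-bound-constant =
        let K , 1≤K , reduce = error-reduction 0<δ (proj₁ δ<1)
        in K , 1≤K , λ {n} {m} → degree-bound K 1≤K reduce {n} {m}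

  1≤⇒fromℕ-pos : ∀ {K} → 1 ℕ.≤ K → 0# < fromℕ K
  1≤⇒fromℕ-pos (s≤s {n = K} _) = fromℕ-pos K

  fromℕ-divide : ∀ {K s d} → 1 ℕ.≤ K → s ℕ.≤ K ℕ.* d → fromℕ K ⁻¹ * fromℕ s ≤ fromℕ d
  fromℕ-divide {K} {s} {d} 1≤K s≤Kd = begin
    fromℕ K ⁻¹ * fromℕ s                ≤⟨ *-monoˡ-≤ (proj₁ (⁻¹-pos (1≤⇒fromℕ-pos 1≤K))) (fromℕ-mono s≤Kd) ⟩
    fromℕ K ⁻¹ * fromℕ (K ℕ.* d)        ≈⟨ *-congˡ (fromℕ-* K d) ⟩
    fromℕ K ⁻¹ * (fromℕ K * fromℕ d)    ≈⟨ cancel-inverse (fromℕ d) (1≤⇒fromℕ-pos 1≤K) ⟩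
    fromℕ d                             ∎

corollary5p2 :
    ExcludedMiddle 0ℓ →
    (R : RealNumbers) →
    let open RealNumbers R
        open ApproximateDegree R
    in
    ∀ (β : ℝ) → 0# < β → β ≤ 1# →
    ∃ λ (c : ℝ) → 0# < c ×
      (∀ (n m : ℕ) → 1 ℕ.≤ n → 1 ℕ.≤ m →
       (X : Fin n → Pred (Point m) 0ℓ) → (∀ i → IsFiniteSet (X i)) →
       (g : ∀ i → BooleanFunction (X i)) →
       (d : ℕ) → IsDeg (1# - β ^ n) (⨂ g) d →
       (dᵢ : Fin n → ℕ) → (∀ i → IsDeg ⅓ (g i) (dᵢ i)) →
       (s : ℕ) → IsMinSubsetSum ⌈ 99 ℕ.* n / 100 ⌉ dᵢ s →
       c * fromℕ s ≤ fromℕ d)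
corollary5p2 em R β 0<β β≤1 =
  let open RealNumbers R
      open OrderedField R using (⁻¹-pos)
      open Main em R
      -- N = 100 matches k = ⌊n/100⌋, the number of coordinates given up when ⌈0.99n⌉ are kept.
      K , 1≤K , bound = degree-bound-constant 0<β β≤1 100 (s≤s z≤n)
  in fromℕ K ⁻¹ , ⁻¹-pos (1≤⇒fromℕ-pos 1≤K) , λ n m _ _ X X-finite g d d-deg dᵢ dᵢ-deg s s-min →
       fromℕ-divide {K} 1≤K (bound ⌈ 99 ℕ.* n / 100 ⌉ (n ℕ./ 100) (⌈99n/100⌉+n/100≤n n) (n<100*[1+n/100] n)
         X X-finite g d d-deg dᵢ dᵢ-deg s s-min)
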